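{- Let $G=(V,E)$ be a graph with $n=|V|$, $m=|E|$, and fix integers $c\ge 1$, $0\le k\le n$ and $\ell>k$. Let ${\bf s}_G$ be the string associated to $G,c,\ell$ as described in the context. Then $G$ has a vertex cover of size $k$ if and only if there is a $c$-BLZ parsing of ${\bf s}_G$ of size $4n+6m+k+\ell(c-1)$.
   Context: Strings: for ${\bf s}=s_1\dots s_N$ and $1\le i\le j\le N$, ${\bf s}[i,j]=s_i\dots s_j$. A parsing of ${\bf s}$ is a partition of ${\bf s}$ into consecutive nonempty substrings called phrases; its size is the number of phrases. An LZ-parsing is a parsing in which every phrase ${\bf s}[a,e]$ either has length $1$, or is given together with a chosen source start $b$ with $1\le b\le a-1$ and ${\bf s}[b,b+(e-a)-1]={\bf s}[a,e-1]$ (the source may overlap the phrase). For such a phrase, each position $a+t$ with $0\le t\le e-a-1$ has source position $b+(t \bmod (a-b))$. The hop-number of a position $p$ is $hop(p)=0$ if $p$ is the last position of a phrase, and $hop(p)=hop(q)+1$ where $q<p$ is the source position of $p$ otherwise. A $c$-BLZ parsing is an LZ-parsing in which every position has hop-number at most $c$. Construction: $G$ is a simple undirected graph with $V=\{v_1,\dots,v_n\}$, $E=\{e_1,\dots,e_m\}$; for each edge $e_i$ fix an ordering $(v_p,v_q)$ of its endpoints. Use pairwise distinct symbols $v_i,v_i',\#^v_i$ ($i\in[n]$), $e_i,\$_i,\#^e_i$ ($i\in[m]$), $\#^p_t$ ($t\in[n+m]$), and $\#^{(i)}_\gamma$ ($1\le i\le c-1$, $1\le\gamma\le\ell$). Define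 $P=v_1\#^p_1\cdots v_n\#^p_n e_1\#^p_{n+1}\cdots e_m\#^p_{n+m}$; $X_i=v_i'\,v_i\,\#^v_i$, $X=X_1\cdots X_n$; for $e_i=(v_p,v_q)$, $Y_i=v_p'\,v_p\,e_i\,\$_i\,v_q'\,v_q\,e_i\,\$_i\,\#^e_i$, $Y=Y_1\cdots Y_m$; ${\bf s}^{(1)}=PXY$. Set $\alpha^{(1)}={\bf s}^{(1)}$, and for $i\ge1$: $\beta^{(i)}=\alpha^{(i)}\#^{(i)}_1\,\alpha^{(i)}\#^{(i)}_2\cdots\alpha^{(i)}\#^{(i)}_\ell$ and $\alpha^{(i+1)}=\alpha^{(i)}\beta^{(i)}$. Finally ${\bf s}_G=\alpha^{(c)}=\alpha^{(1)}\beta^{(1)}\beta^{(2)}\cdots\beta^{(c-1)}$. A vertex cover of $G$ is a set $C\subseteq V$ meeting every edge. -}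

module Defs where

open import Data.Nat using (ℕ; zero; suc; _+_; _*_; _∸_; _≤_; _<_)
open import Data.Nat.DivMod using (_%_)
open import Data.Fin using (Fin; toℕ)
open import Data.Fin.Subset using (Subset; _∈_; ∣_∣)
open import Data.List using (List; []; _∷_; _++_; [_]; concat; tabulate; length)
open import Data.List.Relation.Unary.Any using (Any)
open import Data.Maybe using (Maybe; just; nothing)
open import Data.Product using (Σ; ∃; _×_; _,_; proj₁; proj₂)
open import Data.Sum using (_⊎_)
open import Relation.Binary.PropositionalEquality using (_≡_; _≢_)
open import Relation.Nullary using (¬_)

-- Graphs: n vertices (Fin n), m edges; edge i has a fixed ordering
-- (v_p , v_q) of its endpoints.

record Graph (n m : ℕ) : Set where
  field
    edge : Fin m → Fin n × Fin n

open Graph public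

IsSimple : ∀ {n m} → Graph n m → Set
IsSimple {n} {m} G =
  (∀ i → proj₁ (edge G i) ≢ proj₂ (edge G i)) ×
  (∀ i j → i ≢ j →
     (edge G i ≢ edge G j) ×
     (edge G i ≢ (proj₂ (edge G j) , proj₁ (edge G j))))

HasVertexCover : ∀ {n m} → Graph n m → ℕ → Set
HasVertexCover {n} {m} G k =
  Σ (Subset n) λ C → (∣ C ∣ ≡ k) ×
    (∀ i → (proj₁ (edge G i) ∈ C) ⊎ (proj₂ (edge G i) ∈ C))

-- Symbols (pairwise distinct by construction; indices 1-based as in paper)

data Sym : Set where
  v v' #v : ℕ → Sym
  e $ #e  : ℕ → Sym
  #p      : ℕ → Sym
  #c      : ℕ → ℕ → Sym

Str : Set
Str = List Sym

one : ∀ {k} → Fin k → ℕ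
one i = suc (toℕ i)

module Construction {n m : ℕ} (G : Graph n m) (c ℓ : ℕ) where

  P : Str
  P = concat (tabulate {n = n} (λ i → v (one i) ∷ #p (one i) ∷ []))
      ++ concat (tabulate {n = m} (λ i → e (one i) ∷ #p (n + one i) ∷ []))

  X : Str
  X = concat (tabulate {n = n} (λ i → v' (one i) ∷ v (one i) ∷ #v (one i) ∷ []))

  Yi : Fin m → Str
  Yi i = let p = one (proj₁ (edge G i)) ; q = one (proj₂ (edge G i)) ; j = one i in
    v' p ∷ v p ∷ e j ∷ $ j ∷ v' q ∷ v q ∷ e j ∷ $ j ∷ #e j ∷ []

  Y : Str
  Y = concat (tabulate Yi)

  s1 : Str
  s1 = P ++ X ++ Y

  β : ℕ → Str → Str
  β i α = concat (tabulate {n = ℓ} (λ γ → α ++ [ #c i (one γ) ]))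

  -- α j  represents  α^{(j+1)}
  α : ℕ → Str
  α zero    = s1
  α (suc j) = α j ++ β (suc j) (α j)

  -- s_G = α^{(c)}  (c ≥ 1)
  sG : Str
  sG = α (c ∸ 1)

-- LZ-parsings.  Positions are 0-based here (paper: 1-based).
-- A phrase has a length and an optional source start.

record Phrase : Set where
  constructor phrase
  field
    len : ℕ
    src : Maybe ℕ

open Phrase public

Parsing : Set
Parsing = List Phrase

_!_ : Str → ℕ → Maybe Sym
[]      ! _     = nothing
(x ∷ s) ! zero  = just x
(x ∷ s) ! suc i = s ! i

PhraseOK : Str → ℕ → Phrase → Set
PhraseOK s a (phrase L nothing)  = L ≡ 1
PhraseOK s a (phrase L (just b)) =
  (1 ≤ L) × (b < a) × (∀ t → suc t < L → s ! (b + t) ≡ s ! (a + t))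

ValidFrom : Str → ℕ → Parsing → Set
ValidFrom s a []        = a ≡ length s
ValidFrom s a (ph ∷ ps) = PhraseOK s a ph × ValidFrom s (a + len ph) ps

IsLZParsing : Str → Parsing → Set
IsLZParsing s ps = ValidFrom s 0 ps

starts : ℕ → Parsing → List (ℕ × Phrase)
starts a []        = []
starts a (ph ∷ ps) = (a , ph) ∷ starts (a + len ph) ps

IsLast : Parsing → ℕ → Set
IsLast ps p = Any (λ { (a , ph) → (1 ≤ len ph) × (p ≡ a + len ph ∸ 1) }) (starts 0 ps)

-- q is the source position of p:  p = a + t with t ≤ len-2, and
-- q = b + (t mod (a - b))   (a - b = suc (a ∸ suc b) since b < a)
SourceOf : Parsing → ℕ → ℕ → Set
SourceOf ps p q = Any (λ { (a , ph) →
    Σ ℕ λ b → (src ph ≡ just b) × (b < a) ×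
    Σ ℕ λ t → (suc t < len ph) × (p ≡ a + t) × (q ≡ b + (t % suc (a ∸ suc b))) })
  (starts 0 ps)

data Hop (ps : Parsing) : ℕ → ℕ → Set where
  hop-last : ∀ {p} → IsLast ps p → Hop ps p 0
  hop-src  : ∀ {p q h} → ¬ IsLast ps p → SourceOf ps p q → Hop ps q h → Hop ps p (suc h)

IsBLZ : ℕ → Str → Parsing → Set
IsBLZ c s ps = IsLZParsing s ps ×
  (∀ p → p < length s → Σ ℕ λ h → Hop ps p h × (h ≤ c))

{-# OPTIONS --safe #-}

-- From a cover C: split X_i into v' | v | # for i ∈ C and v' | v # otherwise.  A half-block
-- v' v e $ whose vertex is in C can copy v' v in one hop, and then each Y_i takes four phrases;
-- every piece of β^(i) is one phrase copied from position 0, costing one more hop.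
--
-- From a parsing: first occurrences of symbols are phrase ends, and so is one of every adjacent
-- v e in Y.  These ends number 4n + 6m + ℓ(c - 1), so at most k < ℓ ends are "extra".  Since s_G
-- is overlap-free, phrases copy contiguous factors of the string.  In any occurrence of α^(i+1)
-- one of the ℓ pieces has no extra end, so it is copied from an occurrence of α^(i) one hop
-- closer to the ends.  Descending from s_G itself gives an occurrence of s^(1) of hop-number at
-- most 1.  There each Y_i either contains an extra end, or copies a pair v' v from two phrase
-- ends, one of which is extra.  The vertices of the extra ends therefore cover G.

module Submission where

open import Defs
open import Data.Nat using (ℕ; zero; suc; _+_; _*_; _∸_; _≤_; _<_; z≤n; s≤s; _≤?_; _<?_; _≟_)
open import Data.Nat.Properties
open import Data.Nat.DivMod using (_%_; m<n⇒m%n≡m)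
open import Data.Nat.Tactic.RingSolver using (solve-∀)
open import Data.Fin using (Fin; zero; suc; toℕ)
open import Data.Fin.Patterns using (0F; 1F; 2F; 3F; 4F; 5F; 6F; 7F; 8F)
import Data.Fin.Base as Fin
import Data.Fin.Properties as Fin
open import Data.Fin.Subset using (Subset; ∣_∣; inside; outside; _⊆_) renaming (_∈_ to _∈ˢ_; ⊥ to ∅)
open import Data.Fin.Subset.Properties using (_∈?_; ∣⊥∣≡0; ∣p∣≤n; s⊆s; out⊆; drop-there)
open import Data.List as List
  using (List; []; _∷_; _++_; [_]; concat; tabulate; length; filter; applyUpTo; upTo; map; mapMaybe; lookup)
import Data.List.Properties as List
open import Data.List.Membership.Propositional using (find; lose) renaming (_∈_ to _∈ˡ_)
import Data.List.Membership.Propositional.Properties as Mem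
open import Data.List.Relation.Unary.All as All using (All; []; _∷_)
import Data.List.Relation.Unary.All.Properties as All
open import Data.List.Relation.Unary.AllPairs using (_∷_)
open import Data.List.Relation.Unary.Any as Any using (here; there; index; any?)
import Data.List.Relation.Unary.Any.Properties as Any
open import Data.List.Relation.Unary.Unique.Propositional using (Unique)
import Data.List.Relation.Unary.Unique.Propositional.Properties as Unique
open import Data.Maybe as Maybe using (Maybe; just; nothing)
open import Data.Maybe.Properties using (just-injective)
import Data.Maybe.Relation.Unary.Any as MAny
open import Data.Product using (Σ; ∃; _×_; _,_; proj₁; proj₂)
open import Data.Sum as Sum using (_⊎_; inj₁; inj₂)
open import Data.Vec as Vec using (_[_]≔_; []; _∷_; here; there)
open import Data.Vec.Properties using ([]≔-updates; []≔-minimal)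
open import Data.Empty using (⊥; ⊥-elim)
open import Function using (_∘_; id)
open import Function.Bundles using (_⇔_; mk⇔)
open import Relation.Binary.PropositionalEquality
  using (_≡_; _≢_; _≗_; refl; sym; trans; cong; cong₂; subst; subst₂; module ≡-Reasoning)
open import Relation.Nullary using (¬_; Dec; yes; no; contradiction)
open import Relation.Nullary.Decidable using (_×-dec_; _→-dec_; ¬?; toWitness; decidable-stable)

-- Each `v_i` and `e_j` occurs first in P, so the `v` of `X_i` is never forced to be an end. Ending
-- a phrase there costs one phrase and turns `v' v` into a two-letter source of hop-number 0; this
-- is the price of taking `v_i` into the cover. The count 4n + 6m splits into 2n + 2m ends in P, 2n
-- in X (`v'` and `#v`) and 4m in Y (the first `$`, `#e`, and one for each of the two pairs `v e`).
-- The obstacle is that a source may overlap its phrase, and source positions then wrap around.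
-- Overlap-freeness makes the modulus trivial, so that adjacent non-ends have adjacent sources and
-- hop bounds can be followed letter by letter. The occurrence of `s1` reached by the descent need
-- not be the initial one. Away from position 0 every end inside a Y-block repeats an earlier letter
-- and is extra. At position 0 mandatory and extra ends must be told apart, and there the repeated
-- `e $` excludes the one configuration in which no vertex would be paid for.

-- Indexing into strings and into concatenations of equally long blocks

!-++ˡ : ∀ u w {o} → o < length u → (u ++ w) ! o ≡ u ! o
!-++ˡ (x ∷ u) w {zero}  _         = refl
!-++ˡ (x ∷ u) w {suc o} (s≤s o<u) = !-++ˡ u w o<u

!-++ʳ : ∀ u w o → (u ++ w) ! (length u + o) ≡ w ! o
!-++ʳ []      w o = refl
!-++ʳ (x ∷ u) w o = !-++ʳ u w o

!-total : ∀ u {o} → o < length u → ∃ λ x → u ! o ≡ just x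
!-total (x ∷ u) {zero}  _         = x , refl
!-total (x ∷ u) {suc o} (s≤s o<u) = !-total u o<u

!-bound : ∀ u {o x} → u ! o ≡ just x → o < length u
!-bound (x ∷ u) {zero}  _  = s≤s z≤n
!-bound (x ∷ u) {suc o} eq = s≤s (!-bound u eq)

module _ {A : Set} where

  length-blocks : ∀ {n} (f : Fin n → List A) w → (∀ i → length (f i) ≡ w) →
                  length (concat (tabulate f)) ≡ n * w
  length-blocks {zero}  f w len = refl
  length-blocks {suc n} f w len = trans (List.length-++ (f zero))
    (cong₂ _+_ (len zero) (length-blocks (f ∘ suc) w (len ∘ suc)))

  ∈-blocks : ∀ {n} (f : Fin n → List A) i {x} → x ∈ˡ f i → x ∈ˡ concat (tabulate f)
  ∈-blocks f i x∈ = Mem.∈-concat⁺′ x∈ (Mem.∈-tabulate⁺ i)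

  injection⇒≤length : ∀ {k} (ys : List A) (f : Fin k → A) →
    (∀ {i j} → f i ≡ f j → i ≡ j) → (∀ i → f i ∈ˡ ys) → k ≤ length ys
  injection⇒≤length ys f inj f∈ = Fin.injective⇒≤ {f = λ i → index (f∈ i)} λ {i} {j} eq →
    inj (trans (Any.lookup-index (f∈ i)) (trans (cong (lookup ys) eq) (sym (Any.lookup-index (f∈ j)))))

  Unique-lookup : ∀ {xs : List A} → Unique xs → ∀ {i j} → lookup xs i ≡ lookup xs j → i ≡ j
  Unique-lookup (_ ∷ _) {zero}  {zero}  eq = refl
  Unique-lookup (p ∷ _) {zero}  {suc j} eq = contradiction eq (All.lookup p (Mem.∈-lookup j))
  Unique-lookup (p ∷ _) {suc i} {zero}  eq = contradiction (sym eq) (All.lookup p (Mem.∈-lookup i))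
  Unique-lookup (_ ∷ u) {suc i} {suc j} eq = cong suc (Unique-lookup u eq)

!-blocks : ∀ {n} (f : Fin n → Str) w → (∀ i → length (f i) ≡ w) →
           ∀ i {o} → o < w → concat (tabulate f) ! (toℕ i * w + o) ≡ f i ! o
!-blocks f w len zero    o<w = !-++ˡ (f zero) _ (subst (_ <_) (sym (len zero)) o<w)
!-blocks f w len (suc i) {o} o<w = begin
  (f zero ++ rest) ! (w + toℕ i * w + o)                 ≡⟨ cong ((f zero ++ rest) !_) (+-assoc w _ o) ⟩
  (f zero ++ rest) ! (w + (toℕ i * w + o))               ≡⟨ cong (λ z → (f zero ++ rest) ! (z + _)) (sym (len zero)) ⟩
  (f zero ++ rest) ! (length (f zero) + (toℕ i * w + o)) ≡⟨ !-++ʳ (f zero) rest _ ⟩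
  rest ! (toℕ i * w + o)                                 ≡⟨ !-blocks (f ∘ suc) w (len ∘ suc) i o<w ⟩
  f (suc i) ! o                                          ∎
  where
  open ≡-Reasoning
  rest = concat (tabulate (f ∘ suc))

split-< : ∀ a b {y} → y < a + b → y < a ⊎ ∃ λ o → o < b × y ≡ a + o
split-< a b {y} y< with y <? a
... | yes y<a = inj₁ y<a
... | no  y≮a = inj₂ (y ∸ a , +-cancelˡ-< a _ _ (subst (_< a + b) y≡ y<) , y≡)
  where y≡ = sym (m+[n∸m]≡n (≮⇒≥ y≮a))

locate-block : ∀ n w {y} → y < n * w → ∃ λ (i : Fin n) → ∃ λ o → o < w × y ≡ toℕ i * w + o
locate-block (suc n) w y< with split-< w (n * w) y<
... | inj₁ y<w = zero , _ , y<w , refl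
... | inj₂ (o , o< , refl) with locate-block n w o<
... | i , o′ , o′<w , refl = suc i , o′ , o′<w , sym (+-assoc w _ o′)

block-< : ∀ n w (i : Fin n) {o} → o < w → toℕ i * w + o < n * w
block-< (suc n) w zero    o<w = ≤-trans o<w (m≤m+n w _)
block-< (suc n) w (suc i) {o} o<w =
  subst (_< w + n * w) (sym (+-assoc w _ o)) (+-monoʳ-< w (block-< n w i o<w))

block-injective : ∀ w i i′ {o o′} → o < w → o′ < w → i * w + o ≡ i′ * w + o′ → i ≡ i′
block-injective w zero    zero     o< o′< eq = refl
block-injective w zero    (suc i′) o< o′< eq =
  contradiction (subst (_< w) (trans eq (+-assoc w _ _)) o<) (≤⇒≯ (m≤m+n w _))
block-injective w (suc i) zero     o< o′< eq =
  contradiction (subst (_< w) (trans (sym eq) (+-assoc w _ _)) o′<) (≤⇒≯ (m≤m+n w _))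
block-injective w (suc i) (suc i′) o< o′< eq = cong suc (block-injective w i i′ o< o′<
  (+-cancelˡ-≡ w _ _ (trans (sym (+-assoc w _ _)) (trans eq (+-assoc w _ _)))))

-- Counting mandatory units together with a surplus

cnt : (ℕ → ℕ) → ℕ → ℕ
cnt f zero    = 0
cnt f (suc l) = f 0 + cnt (f ∘ suc) l

cnt-cong : ∀ {f g} → f ≗ g → ∀ l → cnt f l ≡ cnt g l
cnt-cong f≗g zero    = refl
cnt-cong f≗g (suc l) = cong₂ _+_ (f≗g 0) (cnt-cong (f≗g ∘ suc) l)

cnt-+ : ∀ f l l′ → cnt f (l + l′) ≡ cnt f l + cnt (λ o → f (l + o)) l′
cnt-+ f zero    l′ = refl
cnt-+ f (suc l) l′ = trans (cong (f 0 +_) (cnt-+ (f ∘ suc) l l′)) (sym (+-assoc (f 0) _ _))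

-- The weight of f on [a , a + l) pays for b mandatory units and one unit per element of xs.
record Surplus (f : ℕ → ℕ) (a l b : ℕ) (xs : List ℕ) : Set where
  constructor surplus
  field paid : b + length xs ≤ cnt (λ o → f (a + o)) l

surplus-++ : ∀ f a {l l′ b b′ xs ys} → Surplus f a l b xs → Surplus f (a + l) l′ b′ ys →
             Surplus f a (l + l′) (b + b′) (xs ++ ys)
surplus-++ f a {l} {l′} {b} {b′} {xs} {ys} (surplus p) (surplus q) = surplus (begin
  b + b′ + length (xs ++ ys)         ≡⟨ cong (b + b′ +_) (List.length-++ xs) ⟩
  b + b′ + (length xs + length ys)   ≡⟨ +-assoc b b′ _ ⟩
  b + (b′ + (length xs + length ys)) ≡⟨ cong (b +_) (sym (+-assoc b′ _ _)) ⟩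
  b + (b′ + length xs + length ys)   ≡⟨ cong (λ z → b + (z + length ys)) (+-comm b′ _) ⟩
  b + (length xs + b′ + length ys)   ≡⟨ cong (b +_) (+-assoc (length xs) b′ _) ⟩
  b + (length xs + (b′ + length ys)) ≡⟨ sym (+-assoc b _ _) ⟩
  b + length xs + (b′ + length ys)   ≤⟨ +-mono-≤ p q ⟩
  cnt (λ o → f (a + o)) l + cnt (λ o → f (a + l + o)) l′
    ≡⟨ cong (cnt (λ o → f (a + o)) l +_) (cnt-cong (λ o → cong f (+-assoc a l o)) l′) ⟩
  cnt (λ o → f (a + o)) l + cnt (λ o → f (a + (l + o))) l′
    ≡⟨ sym (cnt-+ (λ o → f (a + o)) l l′) ⟩
  cnt (λ o → f (a + o)) (l + l′)     ∎)
  where open ≤-Reasoning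

surplus-blocks : ∀ f a {n} w b (g : Fin n → List ℕ) →
  (∀ i → Surplus f (a + toℕ i * w) w b (g i)) →
  Surplus f a (n * w) (n * b) (concat (tabulate g))
surplus-blocks f a {zero}  w b g s = surplus z≤n
surplus-blocks f a {suc n} w b g s = surplus-++ f a
  (subst (λ z → Surplus f z w b (g zero)) (+-identityʳ a) (s zero))
  (surplus-blocks f (a + w) w b (g ∘ suc) λ i →
    subst (λ z → Surplus f z w b (g (suc i))) (sym (+-assoc a w _)) (s (suc i)))

tick : {Q : Set} → Dec Q → ℕ
tick (yes _) = 1
tick (no _)  = 0

tick-yes : {Q : Set} (d : Dec Q) → Q → 1 ≤ tick d
tick-yes (yes _) _ = ≤-refl
tick-yes (no ¬q) q = contradiction q ¬q

when : {Q : Set} → Dec Q → ℕ → List ℕ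
when (yes _) y = y ∷ []
when (no _)  y = []

∈-when : ∀ {Q : Set} (d : Dec Q) {y} → Q → y ∈ˡ when d y
∈-when (yes _) _ = here refl
∈-when (no ¬q) q = contradiction q ¬q

length-when : ∀ {Q : Set} (d : Dec Q) {y} → length (when d y) ≤ tick d
length-when (yes _) = ≤-refl
length-when (no _)  = ≤-refl

-- Accounting for two positions of which at least one is an end: one end is mandatory, and a second
-- one is surplus. This is the situation at an adjacent pair `v e`.
length-when-× : ∀ {Q R : Set} (d : Dec Q) (d′ : Dec R) {y} → Q ⊎ R →
                1 + length (when (d ×-dec d′) y) ≤ tick d + tick d′
length-when-× (yes _) (yes _) _        = ≤-refl
length-when-× (yes _) (no _)  _        = ≤-refl
length-when-× (no _)  (yes _) _        = ≤-refl
length-when-× (no ¬q) (no ¬r) (inj₁ q) = contradiction q ¬q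
length-when-× (no ¬q) (no ¬r) (inj₂ r) = contradiction r ¬r

module _ {Q : ℕ → Set} (Q? : ∀ y → Dec (Q y)) where

  bit : ℕ → ℕ
  bit y = tick (Q? y)

  hits : ℕ → ℕ → List ℕ
  hits a l = filter Q? (applyUpTo (a +_) l)

  cnt≡length-filter : ∀ f l → cnt (bit ∘ f) l ≡ length (filter Q? (applyUpTo f l))
  cnt≡length-filter f zero    = refl
  cnt≡length-filter f (suc l) with Q? (f 0)
  ... | yes _ = cong suc (cnt≡length-filter (f ∘ suc) l)
  ... | no  _ = cnt≡length-filter (f ∘ suc) l

  hits-surplus : ∀ a l → Surplus bit a l 0 (hits a l)
  hits-surplus a l = surplus (≤-reflexive (sym (cnt≡length-filter (a +_) l)))

  ∈-hits : ∀ {a l o} → o < l → Q (a + o) → a + o ∈ˡ hits a l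
  ∈-hits {a} o<l q = Mem.∈-filter⁺ Q? (Mem.∈-applyUpTo⁺ (a +_) o<l) q

  cnt≤length : ∀ N (ys : List ℕ) → (∀ {y} → Q y → y ∈ˡ ys) → cnt bit N ≤ length ys
  cnt≤length N ys Q⊆ = subst (_≤ length ys) (sym (cnt≡length-filter id N))
    (injection⇒≤length ys (lookup xs) (Unique-lookup (Unique.filter⁺ Q? (Unique.upTo⁺ N)))
      (λ i → Q⊆ (proj₂ (Mem.∈-filter⁻ Q? {xs = upTo N} (Mem.∈-lookup {xs = xs} i)))))
    where xs = filter Q? (upTo N)

-- Subsets from lists, and padding to a given size

∣insert∣ : ∀ {n} (C : Subset n) x → ∣ C [ x ]≔ inside ∣ ≤ suc ∣ C ∣
∣insert∣ (inside ∷ C)  zero    = n≤1+n _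
∣insert∣ (outside ∷ C) zero    = ≤-refl
∣insert∣ (inside ∷ C)  (suc x) = s≤s (∣insert∣ C x)
∣insert∣ (outside ∷ C) (suc x) = ∣insert∣ C x

toSubset : ∀ {n} → List (Fin n) → Subset n
toSubset = List.foldr (λ x C → C [ x ]≔ inside) ∅

∣toSubset∣ : ∀ {n} (xs : List (Fin n)) → ∣ toSubset xs ∣ ≤ length xs
∣toSubset∣ {n} []    = ≤-reflexive (∣⊥∣≡0 n)
∣toSubset∣ (x ∷ xs) = ≤-trans (∣insert∣ (toSubset xs) x) (s≤s (∣toSubset∣ xs))

∈-toSubset : ∀ {n x} {xs : List (Fin n)} → x ∈ˡ xs → x ∈ˢ toSubset xs
∈-toSubset {xs = y ∷ xs} (here refl) = []≔-updates (toSubset xs) y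
∈-toSubset {x = x} {xs = y ∷ xs} (there x∈) with x Fin.≟ y
... | yes refl = []≔-updates (toSubset xs) y
... | no x≢y   = []≔-minimal (toSubset xs) x y x≢y (∈-toSubset x∈)

-- The extra ends give at most `k` vertices, whereas a cover of exactly `k` vertices is asked for;
-- `k ≤ n` leaves room for the padding.
enlarge : ∀ {n} (C : Subset n) {k} → ∣ C ∣ ≤ k → k ≤ n → ∃ λ D → ∣ D ∣ ≡ k × C ⊆ D
enlarge []            z≤n      z≤n = [] , refl , λ x∈ → x∈
enlarge (inside ∷ C)  (s≤s C≤) (s≤s k≤) with enlarge C C≤ k≤
... | D , ∣D∣ , C⊆D = inside ∷ D , cong suc ∣D∣ , s⊆s C⊆D
enlarge (outside ∷ C) C≤ k≤ with m≤n⇒m<n∨m≡n k≤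
... | inj₁ (s≤s k≤n) with enlarge C C≤ k≤n
...   | D , ∣D∣ , C⊆D = outside ∷ D , ∣D∣ , s⊆s C⊆D
enlarge (outside ∷ C) C≤ k≤ | inj₂ refl with enlarge C (∣p∣≤n C) ≤-refl
... | D , ∣D∣ , C⊆D = inside ∷ D , cong suc ∣D∣ , out⊆ C⊆D

one-injective : ∀ {k} {i j : Fin k} → one i ≡ one j → i ≡ j
one-injective = Fin.toℕ-injective ∘ suc-injective

-- The layout of s_G

module Layout {n m : ℕ} (G : Graph n m) (c ℓ : ℕ) where

  open Construction G c ℓ public

  fst snd : Fin m → Fin n
  fst j = proj₁ (edge G j)
  snd j = proj₂ (edge G j)

  -- Coordinates for the positions of `s1`: kind of block, index of the block, offset in it. Letters
  -- can then be compared by matching on constructors instead of computing in the concatenation.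
  data Slot : Set where
    slotV : Fin n → Fin 2 → Slot
    slotE : Fin m → Fin 2 → Slot
    slotX : Fin n → Fin 3 → Slot
    slotY : Fin m → Fin 9 → Slot

  letter : Slot → Sym
  letter (slotV i 0F) = v (one i)
  letter (slotV i 1F) = #p (one i)
  letter (slotE j 0F) = e (one j)
  letter (slotE j 1F) = #p (n + one j)
  letter (slotX i 0F) = v' (one i)
  letter (slotX i 1F) = v (one i)
  letter (slotX i 2F) = #v (one i)
  letter (slotY j 0F) = v' (one (fst j))
  letter (slotY j 1F) = v (one (fst j))
  letter (slotY j 2F) = e (one j)
  letter (slotY j 3F) = $ (one j)
  letter (slotY j 4F) = v' (one (snd j))
  letter (slotY j 5F) = v (one (snd j))
  letter (slotY j 6F) = e (one j)
  letter (slotY j 7F) = $ (one j)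
  letter (slotY j 8F) = #e (one j)

  baseV : Fin n → ℕ
  baseV i = toℕ i * 2

  baseE : Fin m → ℕ
  baseE j = n * 2 + toℕ j * 2

  baseX : Fin n → ℕ
  baseX i = n * 2 + m * 2 + toℕ i * 3

  baseY : Fin m → ℕ
  baseY j = n * 2 + m * 2 + n * 3 + toℕ j * 9

  pos : Slot → ℕ
  pos (slotV i o) = baseV i + toℕ o
  pos (slotE j o) = baseE j + toℕ o
  pos (slotX i o) = baseX i + toℕ o
  pos (slotY j o) = baseY j + toℕ o

  private
    bV : Fin n → Str
    bV i = v (one i) ∷ #p (one i) ∷ []
    bE : Fin m → Str
    bE j = e (one j) ∷ #p (n + one j) ∷ []
    bX : Fin n → Str
    bX i = v' (one i) ∷ v (one i) ∷ #v (one i) ∷ []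
    V E : Str
    V = concat (tabulate bV)
    E = concat (tabulate bE)

    |V| : length V ≡ n * 2
    |V| = length-blocks bV 2 (λ _ → refl)
    |E| : length E ≡ m * 2
    |E| = length-blocks bE 2 (λ _ → refl)
    |P| : length P ≡ n * 2 + m * 2
    |P| = trans (List.length-++ V) (cong₂ _+_ |V| |E|)
    |X| : length X ≡ n * 3
    |X| = length-blocks bX 3 (λ _ → refl)
    |Y| : length Y ≡ m * 9
    |Y| = length-blocks Yi 9 (λ _ → refl)

    front : ∀ {a} u w {o} → length u ≡ a → o < a → (u ++ w) ! o ≡ u ! o
    front u w refl = !-++ˡ u w

    shift : ∀ {a} u w o → length u ≡ a → (u ++ w) ! (a + o) ≡ w ! o
    shift u w o refl = !-++ʳ u w o

  length-s1 : length s1 ≡ n * 2 + m * 2 + n * 3 + m * 9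
  length-s1 = begin
    length (P ++ X ++ Y)            ≡⟨ List.length-++ P ⟩
    length P + length (X ++ Y)      ≡⟨ cong (length P +_) (List.length-++ X) ⟩
    length P + (length X + length Y) ≡⟨ cong₂ _+_ |P| (cong₂ _+_ |X| |Y|) ⟩
    n * 2 + m * 2 + (n * 3 + m * 9) ≡⟨ sym (+-assoc (n * 2 + m * 2) _ _) ⟩
    n * 2 + m * 2 + n * 3 + m * 9   ∎
    where open ≡-Reasoning

  private
    atV : ∀ i {o} → o < 2 → s1 ! (baseV i + o) ≡ bV i ! o
    atV i {o} o< = begin
      s1 ! (baseV i + o) ≡⟨ front P (X ++ Y) |P| (≤-trans o<V (m≤m+n _ _)) ⟩
      P ! (baseV i + o)  ≡⟨ front V E |V| o<V ⟩
      V ! (baseV i + o)  ≡⟨ !-blocks bV 2 (λ _ → refl) i o< ⟩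
      bV i ! o           ∎
      where
      open ≡-Reasoning
      o<V = block-< n 2 i o<

    atE : ∀ j {o} → o < 2 → s1 ! (baseE j + o) ≡ bE j ! o
    atE j {o} o< = begin
      s1 ! (baseE j + o)             ≡⟨ cong (s1 !_) (+-assoc (n * 2) _ o) ⟩
      s1 ! (n * 2 + (toℕ j * 2 + o)) ≡⟨ front P (X ++ Y) |P| (+-monoʳ-< (n * 2) (block-< m 2 j o<)) ⟩
      P ! (n * 2 + (toℕ j * 2 + o))  ≡⟨ shift V E _ |V| ⟩
      E ! (toℕ j * 2 + o)            ≡⟨ !-blocks bE 2 (λ _ → refl) j o< ⟩
      bE j ! o                       ∎
      where open ≡-Reasoning

    atX : ∀ i {o} → o < 3 → s1 ! (baseX i + o) ≡ bX i ! o
    atX i {o} o< = begin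
      s1 ! (baseX i + o)                     ≡⟨ cong (s1 !_) (+-assoc (n * 2 + m * 2) _ o) ⟩
      s1 ! (n * 2 + m * 2 + (toℕ i * 3 + o)) ≡⟨ shift P (X ++ Y) _ |P| ⟩
      (X ++ Y) ! (toℕ i * 3 + o)             ≡⟨ front X Y |X| (block-< n 3 i o<) ⟩
      X ! (toℕ i * 3 + o)                    ≡⟨ !-blocks bX 3 (λ _ → refl) i o< ⟩
      bX i ! o                               ∎
      where open ≡-Reasoning

    atY : ∀ j {o} → o < 9 → s1 ! (baseY j + o) ≡ Yi j ! o
    atY j {o} o< = begin
      s1 ! (baseY j + o)                               ≡⟨ cong (s1 !_) (reassoc (n * 2 + m * 2) (n * 3) (toℕ j * 9) o) ⟩
      s1 ! (n * 2 + m * 2 + (n * 3 + (toℕ j * 9 + o))) ≡⟨ shift P (X ++ Y) _ |P| ⟩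
      (X ++ Y) ! (n * 3 + (toℕ j * 9 + o))             ≡⟨ shift X Y _ |X| ⟩
      Y ! (toℕ j * 9 + o)                              ≡⟨ !-blocks Yi 9 (λ _ → refl) j o< ⟩
      Yi j ! o                                         ∎
      where
      open ≡-Reasoning
      reassoc : ∀ a b c d → a + b + c + d ≡ a + (b + (c + d))
      reassoc a b c d = trans (cong (_+ d) (+-assoc a b c)) (trans (+-assoc a (b + c) d) (cong (a +_) (+-assoc b c d)))

  s1-at : ∀ t → s1 ! pos t ≡ just (letter t)
  s1-at (slotV i 0F) = atV i (Fin.toℕ<n {2} 0F)
  s1-at (slotV i 1F) = atV i (Fin.toℕ<n {2} 1F)
  s1-at (slotE j 0F) = atE j (Fin.toℕ<n {2} 0F)
  s1-at (slotE j 1F) = atE j (Fin.toℕ<n {2} 1F)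
  s1-at (slotX i 0F) = atX i (Fin.toℕ<n {3} 0F)
  s1-at (slotX i 1F) = atX i (Fin.toℕ<n {3} 1F)
  s1-at (slotX i 2F) = atX i (Fin.toℕ<n {3} 2F)
  s1-at (slotY j 0F) = atY j (Fin.toℕ<n {9} 0F)
  s1-at (slotY j 1F) = atY j (Fin.toℕ<n {9} 1F)
  s1-at (slotY j 2F) = atY j (Fin.toℕ<n {9} 2F)
  s1-at (slotY j 3F) = atY j (Fin.toℕ<n {9} 3F)
  s1-at (slotY j 4F) = atY j (Fin.toℕ<n {9} 4F)
  s1-at (slotY j 5F) = atY j (Fin.toℕ<n {9} 5F)
  s1-at (slotY j 6F) = atY j (Fin.toℕ<n {9} 6F)
  s1-at (slotY j 7F) = atY j (Fin.toℕ<n {9} 7F)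
  s1-at (slotY j 8F) = atY j (Fin.toℕ<n {9} 8F)

  slotV-bound : ∀ i o → pos (slotV i o) < n * 2
  slotV-bound i o = block-< n 2 i (Fin.toℕ<n o)

  slotE-bound : ∀ j o → pos (slotE j o) < n * 2 + m * 2
  slotE-bound j o = subst (_< n * 2 + m * 2) (sym (+-assoc (n * 2) _ _))
    (+-monoʳ-< (n * 2) (block-< m 2 j (Fin.toℕ<n o)))

  slotX-bound : ∀ i o → pos (slotX i o) < n * 2 + m * 2 + n * 3
  slotX-bound i o = subst (_< n * 2 + m * 2 + n * 3) (sym (+-assoc (n * 2 + m * 2) _ _))
    (+-monoʳ-< (n * 2 + m * 2) (block-< n 3 i (Fin.toℕ<n o)))

  slotX-≥ : ∀ i o → n * 2 + m * 2 ≤ pos (slotX i o)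
  slotX-≥ i o = ≤-trans (m≤m+n _ _) (m≤m+n _ _)

  slotY-≥ : ∀ j o → n * 2 + m * 2 + n * 3 ≤ pos (slotY j o)
  slotY-≥ j o = ≤-trans (m≤m+n _ _) (m≤m+n _ _)

  pos-bound : ∀ t → pos t < length s1
  pos-bound t = !-bound s1 (s1-at t)

  private
    refit : ∀ {w} a b {o} (o<w : o < w) → a + (b + o) ≡ a + b + toℕ (Fin.fromℕ< o<w)
    refit a b o<w = trans (sym (+-assoc a b _)) (cong (a + b +_) (sym (Fin.toℕ-fromℕ< o<w)))

  s1-slot : ∀ {y} → y < length s1 → ∃ λ t → y ≡ pos t
  s1-slot y< with split-< _ (m * 9) (subst (_ <_) length-s1 y<)
  s1-slot _ | inj₂ (_ , y< , refl) with locate-block m 9 y<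
  ... | j , o , o< , refl = slotY j (Fin.fromℕ< o<) , refit _ (toℕ j * 9) o<
  s1-slot _ | inj₁ y< with split-< _ (n * 3) y<
  s1-slot _ | inj₁ _ | inj₂ (_ , y< , refl) with locate-block n 3 y<
  ... | i , o , o< , refl = slotX i (Fin.fromℕ< o<) , refit _ (toℕ i * 3) o<
  s1-slot _ | inj₁ _ | inj₁ y< with split-< _ (m * 2) y<
  s1-slot _ | inj₁ _ | inj₁ _ | inj₂ (_ , y< , refl) with locate-block m 2 y<
  ... | j , o , o< , refl = slotE j (Fin.fromℕ< o<) , refit _ (toℕ j * 2) o<
  s1-slot _ | inj₁ _ | inj₁ _ | inj₁ y< with locate-block n 2 y<
  ... | i , o , o< , refl = slotV i (Fin.fromℕ< o<) , refit 0 (toℕ i * 2) o<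

  -- The index of the symbol is tied to the slot by an equation, so that an occurrence can be split
  -- into its possible slots without unifying `one i` with `one i′`.
  data Occ : Sym → Slot → Set where
    v-V  : ∀ {k i} → k ≡ one i       → Occ (v k)  (slotV i 0F)
    #p-V : ∀ {k i} → k ≡ one i       → Occ (#p k) (slotV i 1F)
    e-E  : ∀ {k j} → k ≡ one j       → Occ (e k)  (slotE j 0F)
    #p-E : ∀ {k j} → k ≡ n + one j   → Occ (#p k) (slotE j 1F)
    v'-X : ∀ {k i} → k ≡ one i       → Occ (v' k) (slotX i 0F)
    v-X  : ∀ {k i} → k ≡ one i       → Occ (v k)  (slotX i 1F)
    #v-X : ∀ {k i} → k ≡ one i       → Occ (#v k) (slotX i 2F)
    v'-Y₁ : ∀ {k j} → k ≡ one (fst j) → Occ (v' k) (slotY j 0F)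
    v-Y₁ : ∀ {k j} → k ≡ one (fst j) → Occ (v k)  (slotY j 1F)
    e-Y₁ : ∀ {k j} → k ≡ one j       → Occ (e k)  (slotY j 2F)
    $-Y₁ : ∀ {k j} → k ≡ one j       → Occ ($ k)  (slotY j 3F)
    v'-Y₂ : ∀ {k j} → k ≡ one (snd j) → Occ (v' k) (slotY j 4F)
    v-Y₂ : ∀ {k j} → k ≡ one (snd j) → Occ (v k)  (slotY j 5F)
    e-Y₂ : ∀ {k j} → k ≡ one j       → Occ (e k)  (slotY j 6F)
    $-Y₂ : ∀ {k j} → k ≡ one j       → Occ ($ k)  (slotY j 7F)
    #e-Y : ∀ {k j} → k ≡ one j       → Occ (#e k) (slotY j 8F)

  letter-occ : ∀ t → Occ (letter t) t
  letter-occ (slotV i 0F) = v-V refl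
  letter-occ (slotV i 1F) = #p-V refl
  letter-occ (slotE j 0F) = e-E refl
  letter-occ (slotE j 1F) = #p-E refl
  letter-occ (slotX i 0F) = v'-X refl
  letter-occ (slotX i 1F) = v-X refl
  letter-occ (slotX i 2F) = #v-X refl
  letter-occ (slotY j 0F) = v'-Y₁ refl
  letter-occ (slotY j 1F) = v-Y₁ refl
  letter-occ (slotY j 2F) = e-Y₁ refl
  letter-occ (slotY j 3F) = $-Y₁ refl
  letter-occ (slotY j 4F) = v'-Y₂ refl
  letter-occ (slotY j 5F) = v-Y₂ refl
  letter-occ (slotY j 6F) = e-Y₂ refl
  letter-occ (slotY j 7F) = $-Y₂ refl
  letter-occ (slotY j 8F) = #e-Y refl

  s1-find : ∀ {y x} → s1 ! y ≡ just x → ∃ λ t → y ≡ pos t × Occ x t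
  s1-find {y} eq with s1-slot (!-bound s1 eq)
  ... | t , refl = t , refl , subst (λ x → Occ x t)
    (just-injective (trans (sym (s1-at t)) eq)) (letter-occ t)

-- Overlap-freeness of the bottom level

NoOverlap : Str → Set
NoOverlap s = ∀ {b d} → 0 < d → b + (d + d) < length s →
  (∀ {t} → t ≤ d → s ! (b + t) ≡ s ! (b + (d + t))) → ⊥

OccursOnlyAt : Str → Sym → ℕ → Set
OccursOnlyAt s x z = ∀ {y} → s ! y ≡ just x → y ≡ z

module _ {s : Str} {b d : ℕ} (rep : ∀ {t} → t ≤ d → s ! (b + t) ≡ s ! (b + (d + t))) where

  -- An overlap is a window of `d + d + 1` letters with period `d`. A letter among its first `d + 1`
  -- has a twin `d` places later, any other letter has one `d` places earlier. Hence no letter in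
  -- the window is unique in the string.
  overlap-partner : ∀ {y} → b ≤ y → y ≤ b + (d + d) →
    (y + d ≤ b + (d + d) × s ! (y + d) ≡ s ! y) ⊎ (∃ λ y′ → y′ + d ≡ y × s ! y′ ≡ s ! y)
  overlap-partner {y} b≤y y≤ with m+[n∸m]≡n b≤y
  ... | eq with y ∸ b
  overlap-partner {y} b≤y y≤ | refl | o with o ≤? d
  ... | yes o≤d = inj₁ (subst (_≤ b + (d + d)) assoc (+-monoʳ-≤ b (+-monoʳ-≤ d o≤d)) ,
                        subst (λ z → s ! z ≡ s ! (b + o)) assoc (sym (rep o≤d)))
    where assoc : b + (d + o) ≡ b + o + d
          assoc = trans (cong (b +_) (+-comm d o)) (sym (+-assoc b o d))
  ... | no o≰d with m+[n∸m]≡n (<⇒≤ (≰⇒> o≰d))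
  ...   | eq with o ∸ d
  overlap-partner b≤y y≤ | refl | .(d + o′) | no o≰d | refl | o′ =
    inj₂ (b + o′ , trans (+-assoc b o′ d) (cong (b +_) (+-comm o′ d)) ,
          rep (+-cancelˡ-≤ d _ _ (+-cancelˡ-≤ b _ _ y≤)))

  overlap-avoids : 0 < d → ∀ {x z} → s ! z ≡ just x → OccursOnlyAt s x z →
                   b ≤ z → ¬ (z ≤ b + (d + d))
  overlap-avoids 0<d {z = z} at only b≤z z≤ with overlap-partner b≤z z≤
  ... | inj₁ (_ , eq)       = <-irrefl (sym (only (trans eq at))) (m<m+n z 0<d)
  ... | inj₂ (y′ , refl , eq) = <-irrefl (only (trans eq at)) (m<m+n y′ 0<d)

module Overlap {n m : ℕ} (G : Graph n m) (c ℓ : ℕ) where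

  open Layout G c ℓ

  -- The vertex blocks use the indices 1 to `n` of `#p` and the edge blocks those above `n`, so the
  -- two ranges are disjoint.
  only-#p-V : ∀ i → OccursOnlyAt s1 (#p (one i)) (pos (slotV i 1F))
  only-#p-V i eq with s1-find eq
  ... | _ , refl , #p-V q = cong (λ i → pos (slotV i 1F)) (sym (one-injective q))
  ... | slotE j _ , refl , #p-E q = ⊥-elim (<⇒≱ (Fin.toℕ<n i)
    (subst (n ≤_) (sym (suc-injective (trans q (+-suc n (toℕ j))))) (m≤m+n n (toℕ j))))

  only-#p-E : ∀ j → OccursOnlyAt s1 (#p (n + one j)) (pos (slotE j 1F))
  only-#p-E j eq with s1-find eq
  ... | _ , refl , #p-E q = cong (λ j → pos (slotE j 1F)) (sym (one-injective (+-cancelˡ-≡ n _ _ q)))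
  ... | slotV i _ , refl , #p-V q = ⊥-elim (<⇒≱ (Fin.toℕ<n i)
    (subst (n ≤_) (suc-injective (trans (sym (+-suc n (toℕ j))) q)) (m≤m+n n (toℕ j))))

  only-#v : ∀ i → OccursOnlyAt s1 (#v (one i)) (pos (slotX i 2F))
  only-#v i eq with s1-find eq
  ... | _ , refl , #v-X q = cong (λ i → pos (slotX i 2F)) (sym (one-injective q))

  only-#e : ∀ j → OccursOnlyAt s1 (#e (one j)) (pos (slotY j 8F))
  only-#e j eq with s1-find eq
  ... | _ , refl , #e-Y q = cong (λ j → pos (slotY j 8F)) (sym (one-injective q))

  private
    kind : Sym → ℕ
    kind (v' _) = 0
    kind (v _)  = 1
    kind (e _)  = 2
    kind ($ _)  = 3
    kind _      = 4

    kindY : Fin 9 → ℕ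
    kindY o = Vec.lookup (0 ∷ 1 ∷ 2 ∷ 3 ∷ 0 ∷ 1 ∷ 2 ∷ 3 ∷ 4 ∷ []) o

    kind-Y : ∀ j o → kind (letter (slotY j o)) ≡ kindY o
    kind-Y j 0F = refl
    kind-Y j 1F = refl
    kind-Y j 2F = refl
    kind-Y j 3F = refl
    kind-Y j 4F = refl
    kind-Y j 5F = refl
    kind-Y j 6F = refl
    kind-Y j 7F = refl
    kind-Y j 8F = refl

    -- The kinds run twice through `v' v e $` before the closing `#e`, so equal kinds are 4 apart.
    -- Forgetting the indices leaves a finite check.
    kindY-distinct : ∀ o o′ → toℕ o < toℕ o′ → toℕ o′ < toℕ o + 4 → kindY o ≢ kindY o′
    kindY-distinct = toWitness {a? = Fin.all? λ o → Fin.all? λ o′ →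
      (toℕ o <? toℕ o′) →-dec (toℕ o′ <? toℕ o + 4) →-dec ¬? (kindY o ≟ kindY o′)} _

  -- A window has at least three letters, so one that starts in P or X reaches the unique separator
  -- of its block. In Y the window must stop before `#e` at offset 8, which forces `d < 4`, and
  -- letters less than 4 apart differ in kind.
  s1-noOverlap : NoOverlap s1
  s1-noOverlap {b} {d} 0<d b+2d< rep = go (s1-slot (≤-<-trans (m≤m+n b _) b+2d<))
    where
    avoid : ∀ t k o o′ → b ≡ k + o → pos t ≡ k + o′ → OccursOnlyAt s1 (letter t) (pos t) →
            o ≤ o′ → ¬ (o′ ≤ o + (d + d))
    avoid t k o o′ refl eq only o≤o′ o′≤ = overlap-avoids {s1} rep 0<d (s1-at t) only
      (subst (k + o ≤_) (sym eq) (+-monoʳ-≤ k o≤o′))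
      (subst₂ _≤_ (sym eq) (sym (+-assoc k o _)) (+-monoʳ-≤ k o′≤))

    within : ∀ {o o′} → o′ ≤ 2 + o → o′ ≤ o + (d + d)
    within {o} o′≤ = ≤-trans o′≤ (≤-trans (≤-reflexive (+-comm 2 o)) (+-monoʳ-≤ o (+-mono-≤ 0<d 0<d)))

    go : (∃ λ t → b ≡ pos t) → ⊥
    go (slotV i o , eq) = avoid (slotV i 1F) (baseV i) (toℕ o) 1 eq refl (only-#p-V i)
      (≤-pred (Fin.toℕ<n o)) (within {toℕ o} (s≤s z≤n))
    go (slotE j o , eq) = avoid (slotE j 1F) (baseE j) (toℕ o) 1 eq refl (only-#p-E j)
      (≤-pred (Fin.toℕ<n o)) (within {toℕ o} (s≤s z≤n))
    go (slotX i o , eq) = avoid (slotX i 2F) (baseX i) (toℕ o) 2 eq refl (only-#v i)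
      (≤-pred (Fin.toℕ<n o)) (within {toℕ o} (s≤s (s≤s z≤n)))
    go (slotY j o , eq) = kindY-distinct o o′
      (subst (toℕ o <_) (sym toℕ-o′) (m<m+n (toℕ o) 0<d))
      (subst (_< toℕ o + 4) (sym toℕ-o′) (+-monoʳ-< (toℕ o) d<4))
      (trans (sym (kind-Y j o)) (trans (cong kind same) (kind-Y j o′)))
      where
      o+2d<8 : toℕ o + (d + d) < 8
      o+2d<8 = ≰⇒> (avoid (slotY j 8F) (baseY j) (toℕ o) 8 eq refl (only-#e j) (≤-pred (Fin.toℕ<n o)))
      d<4 : d < 4
      d<4 = ≰⇒> λ 4≤d → <⇒≱ o+2d<8 (≤-trans (+-mono-≤ 4≤d 4≤d) (m≤n+m _ (toℕ o)))
      o+d<9 : toℕ o + d < 9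
      o+d<9 = s≤s (≤-trans (+-monoʳ-≤ (toℕ o) (m≤m+n d d)) (<⇒≤ o+2d<8))
      o′ = Fin.fromℕ< o+d<9
      toℕ-o′ = Fin.toℕ-fromℕ< o+d<9
      b+d≡ : b + (d + 0) ≡ baseY j + toℕ o′
      b+d≡ = trans (cong₂ _+_ eq (+-identityʳ d))
        (trans (+-assoc (baseY j) (toℕ o) d) (cong (baseY j +_) (sym toℕ-o′)))
      same : letter (slotY j o) ≡ letter (slotY j o′)
      same = just-injective (begin
        just (letter (slotY j o))   ≡⟨ sym (s1-at (slotY j o)) ⟩
        s1 ! (baseY j + toℕ o)      ≡⟨ cong (s1 !_) (trans (sym eq) (sym (+-identityʳ b))) ⟩
        s1 ! (b + 0)                ≡⟨ rep z≤n ⟩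
        s1 ! (b + (d + 0))          ≡⟨ cong (s1 !_) b+d≡ ⟩
        s1 ! (baseY j + toℕ o′)     ≡⟨ s1-at (slotY j o′) ⟩
        just (letter (slotY j o′))  ∎)
        where open ≡-Reasoning

  -- The levels: prefix, copies and separators

  A : ℕ → ℕ
  A j = length (α j)

  -- The o-th position of the γ-th copy of α j in β (suc j); o = A j is its separator.
  at : ℕ → ℕ → ℕ → ℕ
  at j γ o = A j + (γ * suc (A j) + o)

  private
    piece : ℕ → Fin ℓ → Str
    piece j γ = α j ++ [ #c (suc j) (one γ) ]

    |piece| : ∀ j γ → length (piece j γ) ≡ suc (A j)
    |piece| j γ = trans (List.length-++ (α j)) (+-comm (A j) 1)

  A-suc : ∀ j → A (suc j) ≡ A j + ℓ * suc (A j)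
  A-suc j = trans (List.length-++ (α j)) (cong (A j +_) (length-blocks (piece j) (suc (A j)) (|piece| j)))

  at-bound : ∀ j (γ : Fin ℓ) {o} → o ≤ A j → at j (toℕ γ) o < A (suc j)
  at-bound j γ {o} o≤ = subst (at j (toℕ γ) o <_) (sym (A-suc j)) (+-monoʳ-< (A j) (block-< ℓ (suc (A j)) γ (s≤s o≤)))

  α-prefix : ∀ j {y} → y < A j → α (suc j) ! y ≡ α j ! y
  α-prefix j = !-++ˡ (α j) _

  private
    in-piece : ∀ j (γ : Fin ℓ) {o} → o ≤ A j → α (suc j) ! at j (toℕ γ) o ≡ piece j γ ! o
    in-piece j γ o≤ = trans (!-++ʳ (α j) _ _) (!-blocks (piece j) (suc (A j)) (|piece| j) γ (s≤s o≤))

  α-copy : ∀ j (γ : Fin ℓ) {o} → o < A j → α (suc j) ! at j (toℕ γ) o ≡ α j ! o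
  α-copy j γ o< = trans (in-piece j γ (<⇒≤ o<)) (!-++ˡ (α j) _ o<)

  α-separator : ∀ j (γ : Fin ℓ) → α (suc j) ! at j (toℕ γ) (A j) ≡ just (#c (suc j) (one γ))
  α-separator j γ = trans (in-piece j γ ≤-refl)
    (trans (cong (piece j γ !_) (sym (+-identityʳ (A j)))) (!-++ʳ (α j) _ 0))

  data α-View (j y : ℕ) : Set where
    prefix    : y < A j → α-View j y
    copy      : ∀ (γ : Fin ℓ) {o} → o < A j → y ≡ at j (toℕ γ) o → α-View j y
    separator : ∀ (γ : Fin ℓ) → y ≡ at j (toℕ γ) (A j) → α-View j y

  α-view : ∀ j {y} → y < A (suc j) → α-View j y
  α-view j y< with split-< (A j) (ℓ * suc (A j)) (subst (_ <_) (A-suc j) y<)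
  ... | inj₁ y<A = prefix y<A
  ... | inj₂ (_ , z< , refl) with locate-block ℓ (suc (A j)) z<
  ... | γ , o , s≤s o≤A , refl with m≤n⇒m<n∨m≡n o≤A
  ... | inj₁ o<A  = copy γ o<A refl
  ... | inj₂ refl = separator γ refl

  A-mono : ∀ {i} j → i ≤ j → A i ≤ A j
  A-mono zero  z≤n = ≤-refl
  A-mono (suc j) i≤ with m≤n⇒m<n∨m≡n i≤
  ... | inj₂ refl      = ≤-refl
  ... | inj₁ (s≤s i≤j) = ≤-trans (A-mono j i≤j) (≤-trans (m≤m+n _ _) (≤-reflexive (sym (A-suc j))))

  α-prefix* : ∀ {i} j {y} → i ≤ j → y < A i → α j ! y ≡ α i ! y
  α-prefix* zero  z≤n y< = refl
  α-prefix* (suc j) i≤  y< with m≤n⇒m<n∨m≡n i≤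
  ... | inj₂ refl      = refl
  ... | inj₁ (s≤s i≤j) = trans (α-prefix j (≤-trans y< (A-mono j i≤j))) (α-prefix* j i≤j y<)

  -- Symbols of level `i` enter only with `β i`. Those of level `suc j` are therefore new in
  -- `α (suc j)`, which makes every separator there unique.
  #c-level : ∀ j {y i k} → α j ! y ≡ just (#c i k) → i ≤ j
  #c-level zero eq with s1-find eq
  ... | _ , _ , ()
  #c-level (suc j) eq with α-view j (!-bound (α (suc j)) eq)
  ... | prefix y<         = m≤n⇒m≤1+n (#c-level j (trans (sym (α-prefix j y<)) eq))
  ... | copy γ o< refl    = m≤n⇒m≤1+n (#c-level j (trans (sym (α-copy j γ o<)) eq))
  ... | separator γ refl with trans (sym (α-separator j γ)) eq
  ...   | refl = ≤-refl

  only-separator : ∀ j (γ : Fin ℓ) → OccursOnlyAt (α (suc j)) (#c (suc j) (one γ)) (at j (toℕ γ) (A j))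
  only-separator j γ eq with α-view j (!-bound (α (suc j)) eq)
  ... | prefix y<         = contradiction (#c-level j (trans (sym (α-prefix j y<)) eq)) 1+n≰n
  ... | copy γ′ o< refl   = contradiction (#c-level j (trans (sym (α-copy j γ′ o<)) eq)) 1+n≰n
  ... | separator γ′ refl = cong (λ γ → at j γ (A j))
    (#c-inj (trans (sym (α-separator j γ′)) eq))
    where #c-inj : ∀ {i a b} → just (#c i (suc a)) ≡ just (#c i (suc b)) → a ≡ b
          #c-inj refl = refl

  -- The final letter marks the border between two adjacent copies of `α j`: it is a `#v` or `#e` at
  -- the bottom level and the last separator above it.
  LastUnique : Str → Set
  LastUnique s = ∃ λ x → ∃ λ z → length s ≡ suc z × s ! z ≡ just x × OccursOnlyAt s x z

  private
    last : ∀ t → length s1 ≡ suc (pos t) → OccursOnlyAt s1 (letter t) (pos t) → LastUnique s1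
    last t len only = letter t , pos t , len , s1-at t , only

    +-end : ∀ a b k → a + (suc k + b) ≡ suc (a + b + k)
    +-end a b k = trans (cong (a +_) (cong suc (+-comm k b)))
      (trans (+-suc a (b + k)) (cong suc (sym (+-assoc a b k))))

  s1-lastUnique : 0 < length s1 → LastUnique s1
  s1-lastUnique 0< = go refl refl
    where
    go : ∀ {n′ m′} → n′ ≡ n → m′ ≡ m → LastUnique s1
    go {zero}  {zero}   refl refl = contradiction length-s1 (>⇒≢ 0<)
    go {suc n′} {zero}  refl refl = last (slotX (Fin.fromℕ n′) 2F)
      (trans length-s1 (trans (+-identityʳ _) (trans (+-end (n * 2 + 0) (n′ * 3) 2)
        (cong (λ k → suc (n * 2 + 0 + k * 3 + 2)) (sym (Fin.toℕ-fromℕ n′))))))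
      (only-#v (Fin.fromℕ n′))
    go {_}     {suc m′} refl refl = last (slotY (Fin.fromℕ m′) 8F)
      (trans length-s1 (trans (+-end (n * 2 + m * 2 + n * 3) (m′ * 9) 8)
        (cong (λ k → suc (n * 2 + m * 2 + n * 3 + k * 9 + 8)) (sym (Fin.toℕ-fromℕ m′)))))
      (only-#e (Fin.fromℕ m′))

  α-lastUnique : 0 < ℓ → ∀ j → 0 < A j → LastUnique (α j)
  α-lastUnique _   zero    0<  = s1-lastUnique 0<
  α-lastUnique 0<ℓ (suc j) _ = #c (suc j) (one γ) , at j (toℕ γ) (A j) , A≡ , α-separator j γ , only-separator j γ
    where
    last<ℓ : ℓ ∸ 1 < ℓ
    last<ℓ = ≤-reflexive (m+[n∸m]≡n 0<ℓ)
    γ : Fin ℓ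
    γ = Fin.fromℕ< last<ℓ
    A≡ : A (suc j) ≡ suc (at j (toℕ γ) (A j))
    A≡ = begin
      A (suc j)                          ≡⟨ A-suc j ⟩
      A j + ℓ * suc (A j)                ≡⟨ cong (λ k → A j + k * suc (A j)) (sym (m+[n∸m]≡n 0<ℓ)) ⟩
      A j + suc (ℓ ∸ 1) * suc (A j)      ≡⟨ cong (A j +_) (+-comm (suc (A j)) _) ⟩
      A j + ((ℓ ∸ 1) * suc (A j) + suc (A j))
        ≡⟨ cong (λ g → A j + (g * suc (A j) + suc (A j))) (sym (Fin.toℕ-fromℕ< last<ℓ)) ⟩
      A j + (toℕ γ * suc (A j) + suc (A j)) ≡⟨ cong (A j +_) (+-suc _ (A j)) ⟩
      A j + suc (toℕ γ * suc (A j) + A j) ≡⟨ +-suc (A j) _ ⟩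
      suc (at j (toℕ γ) (A j))           ∎
      where open ≡-Reasoning

  -- No window meets a separator, and one inside the prefix or inside a copy is already an overlap
  -- of `α j`. What remains is a window running from the prefix into the first copy, across the
  -- border in `α j α j`.
  α-noOverlap : 0 < ℓ → ∀ j → NoOverlap (α j)
  α-noOverlap 0<ℓ zero = s1-noOverlap
  α-noOverlap 0<ℓ (suc j) {b} {d} 0<d b+2d< rep with b + (d + d) <? A j
  ... | yes b+2d<A = α-noOverlap 0<ℓ j 0<d b+2d<A λ {t} t≤d →
    trans (sym (α-prefix j (≤-<-trans (+-monoʳ-≤ b (≤-trans t≤d (m≤m+n d d))) b+2d<A)))
      (trans (rep t≤d) (α-prefix j (≤-<-trans (+-monoʳ-≤ b (+-monoʳ-≤ d t≤d)) b+2d<A)))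
  ... | no b+2d≮A with α-view j (≤-<-trans (m≤m+n b (d + d)) b+2d<)
  ...   | separator γ refl = overlap-avoids {α (suc j)} rep 0<d (α-separator j γ) (only-separator j γ) ≤-refl (m≤m+n _ _)
  ...   | copy γ {o} o<A refl = α-noOverlap 0<ℓ j 0<d o+2d<A λ {t} t≤d →
    trans (sym (shifted (+-monoʳ-≤ o (≤-trans t≤d (m≤m+n d d)))))
      (trans (rep t≤d) (shifted (+-monoʳ-≤ o (+-monoʳ-≤ d t≤d))))
    where
    at-+ : ∀ t → at j (toℕ γ) o + t ≡ at j (toℕ γ) (o + t)
    at-+ t = trans (+-assoc (A j) _ t) (cong (A j +_) (+-assoc _ o t))
    o+2d<A : o + (d + d) < A j
    o+2d<A = ≰⇒> λ A≤ → overlap-avoids {α (suc j)} rep 0<d (α-separator j γ) (only-separator j γ)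
      (+-monoʳ-≤ (A j) (+-monoʳ-≤ (toℕ γ * suc (A j)) (<⇒≤ o<A)))
      (subst (at j (toℕ γ) (A j) ≤_) (sym (at-+ (d + d))) (+-monoʳ-≤ (A j) (+-monoʳ-≤ (toℕ γ * suc (A j)) A≤)))
    shifted : ∀ {t} → o + t ≤ o + (d + d) → α (suc j) ! (at j (toℕ γ) o + t) ≡ α j ! (o + t)
    shifted {t} le = trans (cong (α (suc j) !_) (at-+ t)) (α-copy j γ (≤-<-trans le o+2d<A))
  ...   | prefix b<A with α-lastUnique 0<ℓ j (≤-<-trans z≤n b<A)
  ...     | x , z , A≡ , at-z , only = crossing
    where
    γ : Fin ℓ
    γ = Fin.fromℕ< 0<ℓ
    γ≡0 = Fin.toℕ-fromℕ< 0<ℓ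
    z<A : z < A j
    z<A = ≤-reflexive (sym A≡)
    b≤z : b ≤ z
    b≤z = ≤-pred (subst (b <_) A≡ b<A)
    -- The window avoids the first separator, so it lies in α j ++ α j.
    b+2d<2A : b + (d + d) < A j + A j
    b+2d<2A = ≰⇒> λ le → overlap-avoids {α (suc j)} rep 0<d (α-separator j γ) (only-separator j γ)
      (≤-trans (<⇒≤ b<A) (m≤m+n (A j) _)) (subst (λ g → at j g (A j) ≤ b + (d + d)) (sym γ≡0) le)
    -- The last letter of the prefix lies in the window, so it has a twin at distance `d`. In
    -- `α j α j` the twin can only be the last letter of the first copy; then `d = A j`, and the
    -- window is too long to fit.
    crossing : ⊥
    crossing with overlap-partner {α (suc j)} rep b≤z (≤-trans (<⇒≤ z<A) (≮⇒≥ b+2d≮A))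
    ... | inj₂ (y′ , refl , eq) = <-irrefl
      (only (trans (sym (α-prefix j (≤-<-trans (m≤m+n y′ d) z<A))) (trans eq (trans (α-prefix j z<A) at-z))))
      (m<m+n y′ 0<d)
    ... | inj₁ (z+d≤ , eq) with split-< (A j) (A j) (≤-<-trans z+d≤ b+2d<2A)
    ...   | inj₁ z+d<A = <-irrefl
      (sym (only (trans (sym (α-prefix j z+d<A)) (trans eq (trans (α-prefix j z<A) at-z)))))
      (m<m+n z 0<d)
    ...   | inj₂ (o′ , o′<A , z+d≡) with only {o′} (trans (sym (α-copy j γ o′<A))
            (trans (cong (α (suc j) !_) (trans (cong (λ g → at j g o′) γ≡0) (sym z+d≡)))
              (trans eq (trans (α-prefix j z<A) at-z))))
    ...     | refl = <⇒≱ b+2d<2A (subst (λ d → A j + A j ≤ b + (d + d)) (sym d≡A) (m≤n+m _ b))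
      where d≡A : d ≡ A j
            d≡A = +-cancelˡ-≡ z d (A j) (trans z+d≡ (+-comm (A j) z))

-- LZ-parsings

isLast? : ∀ ps y → Dec (IsLast ps y)
isLast? ps y = any? (λ { (a , ph) → (1 ≤? len ph) ×-dec (y ≟ a + len ph ∸ 1) }) (starts 0 ps)

length-starts : ∀ a ps → length (starts a ps) ≡ length ps
length-starts a []        = refl
length-starts a (ph ∷ ps) = cong suc (length-starts (a + len ph) ps)

lasts≤length : ∀ ps N → cnt (bit (isLast? ps)) N ≤ length ps
lasts≤length ps N = subst (cnt (bit (isLast? ps)) N ≤_)
  (trans (List.length-map end (starts 0 ps)) (length-starts 0 ps))
  (cnt≤length (isLast? ps) N (map end (starts 0 ps)) λ last → let _ , x∈ , _ , y≡ = find last in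
    subst (_∈ˡ _) (sym y≡) (Mem.∈-map⁺ end x∈))
  where
  end : ℕ × Phrase → ℕ
  end (a , ph) = a + len ph ∸ 1

module _ {s : Str} where

  starts-≥ : ∀ {a a′ ph} ps → (a′ , ph) ∈ˡ starts a ps → a ≤ a′
  starts-≥ (ph ∷ ps) (here refl) = ≤-refl
  starts-≥ (ph ∷ ps) (there x∈)  = ≤-trans (m≤m+n _ _) (starts-≥ ps x∈)

  valid-≤ : ∀ {a} ps → ValidFrom s a ps → a ≤ length s
  valid-≤ []        refl     = ≤-refl
  valid-≤ (ph ∷ ps) (_ , ok) = ≤-trans (m≤m+n _ _) (valid-≤ ps ok)

  starts-valid : ∀ {a a′ ph} ps → ValidFrom s a ps → (a′ , ph) ∈ˡ starts a ps →
                 PhraseOK s a′ ph × a′ + len ph ≤ length s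
  starts-valid (ph ∷ ps) (ok , oks) (here refl) = ok , valid-≤ ps oks
  starts-valid (ph ∷ ps) (ok , oks) (there x∈)  = starts-valid ps oks x∈

  starts-cover : ∀ {a y} ps → ValidFrom s a ps → a ≤ y → y < length s →
    ∃ λ a′ → ∃ λ ph → ∃ λ t → (a′ , ph) ∈ˡ starts a ps × t < len ph × y ≡ a′ + t
  starts-cover []        refl a≤y y< = contradiction y< (≤⇒≯ a≤y)
  starts-cover {a} {y} (ph ∷ ps) (ok , oks) a≤y y< with y <? a + len ph
  ... | yes y<a′ = a , ph , y ∸ a , here refl , +-cancelˡ-< a _ _ (subst (_< a + len ph) y≡ y<a′) , y≡
    where y≡ = sym (m+[n∸m]≡n a≤y)
  ... | no  y≮a′ with starts-cover ps oks (≮⇒≥ y≮a′) y<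
  ...   | a′ , ph′ , t , x∈ , rest = a′ , ph′ , t , there x∈ , rest

  starts-unique : ∀ {a a₁ ph₁ t₁ a₂ ph₂ t₂} ps →
    (a₁ , ph₁) ∈ˡ starts a ps → t₁ < len ph₁ →
    (a₂ , ph₂) ∈ˡ starts a ps → t₂ < len ph₂ →
    a₁ + t₁ ≡ a₂ + t₂ → (a₁ , ph₁) ≡ (a₂ , ph₂)
  starts-unique (ph ∷ ps) (here refl) t₁< (here refl) t₂< eq = refl
  starts-unique (ph ∷ ps) (there x₁)  t₁< (there x₂)  t₂< eq = starts-unique ps x₁ t₁< x₂ t₂< eq
  starts-unique {a} (ph ∷ ps) (here refl) t₁< (there x₂) t₂< eq =
    contradiction (subst (_< a + len ph) eq (+-monoʳ-< a t₁<)) (≤⇒≯ (≤-trans (starts-≥ ps x₂) (m≤m+n _ _)))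
  starts-unique {a} (ph ∷ ps) (there x₁) t₁< (here refl) t₂< eq =
    contradiction (subst (_< a + len ph) (sym eq) (+-monoʳ-< a t₂<)) (≤⇒≯ (≤-trans (starts-≥ ps x₁) (m≤m+n _ _)))

+∸1 : ∀ a {L} → 1 ≤ L → a + L ∸ 1 ≡ a + (L ∸ 1)
+∸1 a 1≤L = +-∸-assoc a 1≤L

HopAtMost : Parsing → ℕ → ℕ → Set
HopAtMost ps p h = Σ ℕ λ h′ → Hop ps p h′ × h′ ≤ h

module Parse {s : Str} {ps : Parsing} (valid : IsLZParsing s ps) where

  Copies : ℕ → ℕ → ℕ → ℕ → Set
  Copies a L b t = (a , phrase L (just b)) ∈ˡ starts 0 ps × suc t < L

  copies-or-last : ∀ {y} → y < length s → ¬ IsLast ps y →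
    ∃ λ a → ∃ λ L → ∃ λ b → ∃ λ t → Copies a L b t × y ≡ a + t
  copies-or-last y< ¬last with starts-cover ps valid z≤n y<
  ... | a , phrase L nothing , t , x∈ , t< , refl with starts-valid ps valid x∈
  copies-or-last _ ¬last | a , phrase _ nothing , zero , x∈ , _ , refl | refl , _ =
    contradiction (lose x∈ (s≤s z≤n , sym (+∸1 a (s≤s z≤n)))) ¬last
  copies-or-last _ ¬last | a , phrase _ nothing , suc t , x∈ , s≤s () , refl | refl , _
  copies-or-last _ ¬last | a , phrase L (just b) , t , x∈ , t< , refl with m≤n⇒m<n∨m≡n t<
  ... | inj₁ t+1<L = a , L , b , t , (x∈ , t+1<L) , refl
  ... | inj₂ refl  = contradiction (lose x∈ (s≤s z≤n , sym (+∸1 a (s≤s z≤n)))) ¬last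

  module _ {a L b t : ℕ} (copies : Copies a L b t) where

    private
      x∈   = proj₁ copies
      t+1< = proj₂ copies
      ok   = starts-valid ps valid x∈

    copies-< : b < a
    copies-< = proj₁ (proj₂ (proj₁ ok))

    copies-≡ : s ! (b + t) ≡ s ! (a + t)
    copies-≡ = proj₂ (proj₂ (proj₁ ok)) t t+1<

    copies-not-last : ¬ IsLast ps (a + t)
    copies-not-last last with find last
    ... | (a′ , ph′) , x′∈ , 1≤ , y≡
      with starts-unique {s} ps x∈ (<⇒≤ t+1<) x′∈ (≤-reflexive (m+[n∸m]≡n 1≤)) (trans y≡ (+∸1 a′ 1≤))
    ... | refl with trans (cong suc (+-cancelˡ-≡ a _ _ (trans y≡ (+∸1 a 1≤)))) (m+[n∸m]≡n 1≤)
    ...   | refl = 1+n≰n t+1<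

    copies-next : ¬ IsLast ps (a + suc t) → Copies a L b (suc t)
    copies-next ¬last with m≤n⇒m<n∨m≡n t+1<
    ... | inj₁ t+2<L = x∈ , t+2<L
    ... | inj₂ refl  = contradiction (lose x∈ (s≤s z≤n , sym (+∸1 a (s≤s z≤n)))) ¬last

    -- Otherwise the phrase would prolong the square s[b, a) s[a, 2a - b) to an overlap.
    copies-no-wrap : NoOverlap s → t % suc (a ∸ suc b) ≡ t
    copies-no-wrap noOverlap with m+[n∸m]≡n copies-<
    ... | a≡ with a ∸ suc b
    ...   | d′ = m<n⇒m%n≡m (≰⇒> λ d≤t → noOverlap {b} {d} (s≤s z≤n)
      (subst (_< length s) (trans (cong (_+ d) (sym b+d≡a)) (+-assoc b d d))
        (≤-trans (+-monoʳ-< a (≤-trans (s≤s d≤t) (<⇒≤ t+1<))) (proj₂ ok)))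
      λ {t′} t′≤d → trans (proj₂ (proj₂ (proj₁ ok)) t′ (≤-trans (s≤s (s≤s (≤-trans t′≤d d≤t))) t+1<))
        (cong (s !_) (trans (cong (_+ t′) (sym b+d≡a)) (+-assoc b d t′))))
      where
      d = suc d′
      b+d≡a : b + d ≡ a
      b+d≡a = trans (+-suc b d′) a≡

    -- Only one phrase contains `a + t`, so the derivation of its hop-number passes through that
    -- phrase; without wrapping, the source it names is `b + t`.
    hop-copies : NoOverlap s → ∀ {h} → HopAtMost ps (a + t) (suc h) → HopAtMost ps (b + t) h
    hop-copies _ (_ , hop-last last , _) = contradiction last copies-not-last
    hop-copies noOverlap (suc h′ , hop-src _ source hop , s≤s h′≤) with find source
    ... | (a′ , phrase L′ _) , x′∈ , b′ , refl , b′<a′ , t′ , t′< , y≡ , refl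
      with starts-unique {s} ps x∈ (<⇒≤ t+1<) x′∈ (<⇒≤ t′<) y≡
    ... | refl with +-cancelˡ-≡ a t t′ y≡
    ...   | refl = h′ , subst (λ z → Hop ps z h′) (cong (b +_) (copies-no-wrap noOverlap)) hop , h′≤

  hop-zero : ∀ {y} → HopAtMost ps y 0 → IsLast ps y
  hop-zero (_ , hop-last last , _) = last

-- From a parsing to a vertex cover

module Converse {n m : ℕ} (G : Graph n m) (irreflexive : ∀ j → proj₁ (edge G j) ≢ proj₂ (edge G j))
  (J k ℓ : ℕ) (k<ℓ : k < ℓ) (ps : Parsing) (blz : IsBLZ (suc J) (Construction.sG G (suc J) ℓ) ps)
  (size : length ps ≡ 4 * n + 6 * m + k + ℓ * J) where

  open Overlap G (suc J) ℓ
  open Layout G (suc J) ℓ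
  open Parse {sG} {ps} (proj₁ blz)

  noOverlap : NoOverlap sG
  noOverlap = α-noOverlap (≤-<-trans z≤n k<ℓ) J

  Last : ℕ → Set
  Last = IsLast ps

  last? : ∀ y → Dec (Last y)
  last? = isLast? ps

  Depth : ℕ → ℕ → Set
  Depth = HopAtMost ps

  -- Phrase ends that every parsing must have

  sG-at : ∀ t → sG ! pos t ≡ just (letter t)
  sG-at t = trans (α-prefix* J z≤n (pos-bound t)) (s1-at t)

  sG-s1 : ∀ {y x} → y < A 0 → sG ! y ≡ just x → s1 ! y ≡ just x
  sG-s1 y< eq = trans (sym (α-prefix* J z≤n y<)) eq

  first⇒last : ∀ {y} → y < A J → (∀ {z} → z < y → sG ! z ≢ sG ! y) → Last y
  first⇒last {y} y< first = decidable-stable (last? y) λ ¬last → copied-not-first (copies-or-last y< ¬last)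
    where
    copied-not-first : _ → ⊥
    copied-not-first (a , L , b , t , copies , refl) = first (+-monoˡ-< t (copies-< copies)) (copies-≡ copies)

  first⇒last-s1 : ∀ t → (∀ {t′} → pos t′ < pos t → ¬ Occ (letter t) t′) → Last (pos t)
  first⇒last-s1 t first = first⇒last (≤-trans (pos-bound t) (A-mono J z≤n)) λ z< eq →
    go z< (s1-find (sG-s1 (<-trans z< (pos-bound t)) (trans eq (sG-at t))))
    where
    go : ∀ {z} → z < pos t → (∃ λ t′ → z ≡ pos t′ × Occ (letter t) t′) → ⊥
    go z< (_ , refl , occ) = first z< occ

  only⇒last : ∀ t → OccursOnlyAt s1 (letter t) (pos t) → Last (pos t)
  only⇒last t only = first⇒last (≤-trans (pos-bound t) (A-mono J z≤n)) λ z< eq →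
    <-irrefl (only (sG-s1 (<-trans z< (pos-bound t)) (trans eq (sG-at t)))) z<

  private
    V<X : ∀ {i o i′ o′} → ¬ (pos (slotX i o) < pos (slotV i′ o′))
    V<X {i} {o} {i′} {o′} lt = <⇒≱ (<-trans lt (slotV-bound i′ o′)) (≤-trans (m≤m+n _ _) (slotX-≥ i o))
    X<Y : ∀ {i o j o′} → ¬ (pos (slotY j o′) < pos (slotX i o))
    X<Y {i} {o} {j} {o′} lt = <⇒≱ (<-trans lt (slotX-bound i o)) (slotY-≥ j o′)
    V<Y : ∀ {i o j o′} → ¬ (pos (slotY j o′) < pos (slotV i o))
    V<Y {i} {o} {j} {o′} lt = <⇒≱ (<-trans lt (slotV-bound i o))
      (≤-trans (m≤m+n _ _) (≤-trans (m≤m+n _ _) (slotY-≥ j o′)))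
    E<Y : ∀ {i o j o′} → ¬ (pos (slotY j o′) < pos (slotE i o))
    E<Y {i} {o} {j} {o′} lt = <⇒≱ (<-trans lt (slotE-bound i o)) (≤-trans (m≤m+n _ _) (slotY-≥ j o′))

  last-V0 : ∀ i → Last (pos (slotV i 0F))
  last-V0 i = first⇒last-s1 (slotV i 0F) λ
    { lt (v-V q)            → <-irrefl (cong (λ i → pos (slotV i 0F)) (sym (one-injective q))) lt
    ; lt (v-X {i = i′} _)   → V<X {i′} {1F} {i} {0F} lt
    ; lt (v-Y₁ {j = j} _)   → V<Y {i} {0F} {j} {1F} lt
    ; lt (v-Y₂ {j = j} _)   → V<Y {i} {0F} {j} {5F} lt }

  last-E0 : ∀ j → Last (pos (slotE j 0F))
  last-E0 j = first⇒last-s1 (slotE j 0F) λ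
    { lt (e-E q)           → <-irrefl (cong (λ j → pos (slotE j 0F)) (sym (one-injective q))) lt
    ; lt (e-Y₁ {j = j′} _) → E<Y {j} {0F} {j′} {2F} lt
    ; lt (e-Y₂ {j = j′} _) → E<Y {j} {0F} {j′} {6F} lt }

  last-X0 : ∀ i → Last (pos (slotX i 0F))
  last-X0 i = first⇒last-s1 (slotX i 0F) λ
    { lt (v'-X q)           → <-irrefl (cong (λ i → pos (slotX i 0F)) (sym (one-injective q))) lt
    ; lt (v'-Y₁ {j = j} _) → X<Y {i} {0F} {j} {0F} lt
    ; lt (v'-Y₂ {j = j} _) → X<Y {i} {0F} {j} {4F} lt }

  last-Y3 : ∀ j → Last (pos (slotY j 3F))
  last-Y3 j = first⇒last-s1 (slotY j 3F) λ
    { lt ($-Y₁ q) → <-irrefl (cong (λ j → pos (slotY j 3F)) (sym (one-injective q))) lt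
    ; lt ($-Y₂ q) → case-Y₂ q lt }
    where
    case-Y₂ : ∀ {j′} → one j ≡ one j′ → ¬ (pos (slotY j′ 7F) < pos (slotY j 3F))
    case-Y₂ q lt with one-injective q
    ... | refl = ≤⇒≯ (+-monoʳ-≤ (baseY j) (s≤s (s≤s (s≤s (z≤n {4}))))) lt

  -- Two adjacent positions that are not ends lie in the same phrase, so they are copied from
  -- adjacent positions and both hop bounds drop by one. The arguments about `v' v`, `v e` and `e $`
  -- all rest on this.
  pair-source : ∀ {y} → suc y < A J → ¬ Last y → ¬ Last (suc y) →
    ∃ λ z → z < y × sG ! z ≡ sG ! y × sG ! suc z ≡ sG ! suc y ×
      (∀ {h} → Depth y (suc h) → Depth z h) × (∀ {h} → Depth (suc y) (suc h) → Depth (suc z) h)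
  pair-source y+1< ¬last ¬last′ with copies-or-last (<-trans (n<1+n _) y+1<) ¬last
  ... | a , L , b , t , copies , refl = b + t , +-monoˡ-< t (copies-< copies) , copies-≡ copies ,
      subst₂ (λ z y → sG ! z ≡ sG ! y) (+-suc b t) (+-suc a t) (copies-≡ copies′) ,
      hop-copies copies noOverlap ,
      λ {h} → subst₂ (λ z y → Depth y (suc h) → Depth z h) (+-suc b t) (+-suc a t) (hop-copies copies′ noOverlap)
    where copies′ = copies-next copies (subst (¬_ ∘ Last) (sym (+-suc a t)) ¬last′)

  private
    next : ∀ b o {x} → s1 ! (b + suc o) ≡ x → s1 ! suc (b + o) ≡ x
    next b o {x} = subst (λ y → s1 ! y ≡ x) (+-suc b o)

  clash : ∀ {a b : Sym} {z} → s1 ! z ≡ just a → s1 ! z ≡ just b → a ≡ b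
  clash p q = just-injective (trans (sym p) q)

  private
    e-injective : ∀ {a b} → e a ≡ e b → a ≡ b
    e-injective refl = refl

  -- In P and X a `v` is followed by a separator, so only the two half-blocks of `Y_j` put a `v` in
  -- front of `e_j`.
  v-e-adjacent : ∀ {z a j} → s1 ! z ≡ just (v a) → s1 ! suc z ≡ just (e (one j)) →
    (z ≡ pos (slotY j 1F) × a ≡ one (fst j)) ⊎ (z ≡ pos (slotY j 5F) × a ≡ one (snd j))
  v-e-adjacent eq eq′ with s1-find eq
  ... | slotV i _ , refl , v-V _ with clash (next (baseV i) 0 (s1-at (slotV i 1F))) eq′
  ...   | ()
  v-e-adjacent eq eq′ | slotX i _ , refl , v-X _ with clash (next (baseX i) 1 (s1-at (slotX i 2F))) eq′
  ...   | ()
  v-e-adjacent eq eq′ | slotY j _ , refl , v-Y₁ q with clash (next (baseY j) 1 (s1-at (slotY j 2F))) eq′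
  ...   | q′ with one-injective (e-injective q′)
  ...     | refl = inj₁ (refl , q)
  v-e-adjacent eq eq′ | slotY j _ , refl , v-Y₂ q with clash (next (baseY j) 5 (s1-at (slotY j 6F))) eq′
  ...   | q′ with one-injective (e-injective q′)
  ...     | refl = inj₂ (refl , q)

  e-$-adjacent : ∀ {z j} → s1 ! z ≡ just (e (one j)) → s1 ! suc z ≡ just ($ (one j)) →
    z ≡ pos (slotY j 2F) ⊎ z ≡ pos (slotY j 6F)
  e-$-adjacent eq eq′ with s1-find eq
  ... | slotE j _ , refl , e-E _ with clash (next (baseE j) 0 (s1-at (slotE j 1F))) eq′
  ...   | ()
  e-$-adjacent eq eq′ | _ , refl , e-Y₁ q = inj₁ (cong (λ j → pos (slotY j 2F)) (sym (one-injective q)))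
  e-$-adjacent eq eq′ | _ , refl , e-Y₂ q = inj₂ (cong (λ j → pos (slotY j 6F)) (sym (one-injective q)))

  pos-suc : ∀ b o → suc (b + o) ≡ b + suc o
  pos-suc b o = sym (+-suc b o)

  s1-pair-source : ∀ {b o} → b + suc o < A 0 → ¬ Last (b + o) → ¬ Last (b + suc o) →
    ∃ λ z → z < b + o × s1 ! z ≡ s1 ! (b + o) × s1 ! suc z ≡ s1 ! (b + suc o) ×
      (∀ {h} → Depth (b + o) (suc h) → Depth z h) × (∀ {h} → Depth (b + suc o) (suc h) → Depth (suc z) h)
  s1-pair-source {b} {o} y< ¬last ¬last′ with subst (λ y → y < A 0 × ¬ Last y) (+-suc b o) (y< , ¬last′)
  ... | y<A , ¬last″ with pair-source (≤-trans y<A (A-mono J z≤n)) ¬last ¬last″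
  ... | z , z< , eq , eq′ , depth , depth′ = z , z< ,
    trans (sym (low (<-trans z< (<-trans (n<1+n _) y<A)))) (trans eq (low (<-trans (n<1+n _) y<A))) ,
    subst (λ y → s1 ! suc z ≡ s1 ! y) (pos-suc b o)
      (trans (sym (low (<-trans (s≤s z<) y<A))) (trans eq′ (low y<A))) ,
    depth , λ {h} → subst (λ y → Depth y (suc h) → Depth (suc z) h) (pos-suc b o) depth′
    where
    low : ∀ {y} → y < A 0 → sG ! y ≡ s1 ! y
    low = α-prefix* J z≤n

  -- If neither were an end, the pair would be copied from an earlier `v e_j`; the only other such
  -- pair, at offset 5, comes later.
  last-Y1∨Y2 : ∀ j → Last (pos (slotY j 1F)) ⊎ Last (pos (slotY j 2F))
  last-Y1∨Y2 j with last? (pos (slotY j 1F)) | last? (pos (slotY j 2F))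
  ... | yes l | _     = inj₁ l
  ... | no _  | yes l = inj₂ l
  ... | no ¬l | no ¬l′ with s1-pair-source {baseY j} {1} (pos-bound (slotY j 2F)) ¬l ¬l′
  ... | z , z< , eq , eq′ , _ with v-e-adjacent (trans eq (s1-at (slotY j 1F))) (trans eq′ (s1-at (slotY j 2F)))
  ... | inj₁ (refl , _) = contradiction z< (<-irrefl refl)
  ... | inj₂ (refl , _) = contradiction (+-cancelˡ-< (baseY j) 5 1 z<) λ { (s≤s ()) }

  last-Y5∨Y6 : ∀ j → Last (pos (slotY j 5F)) ⊎ Last (pos (slotY j 6F))
  last-Y5∨Y6 j with last? (pos (slotY j 5F)) | last? (pos (slotY j 6F))
  ... | yes l | _     = inj₁ l
  ... | no _  | yes l = inj₂ l
  ... | no ¬l | no ¬l′ with s1-pair-source {baseY j} {5} (pos-bound (slotY j 6F)) ¬l ¬l′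
  ... | z , z< , eq , eq′ , _ with v-e-adjacent (trans eq (s1-at (slotY j 5F))) (trans eq′ (s1-at (slotY j 6F)))
  -- The earlier pair, at offset 1, carries the first endpoint; equality with the second would make
  -- the edge a loop.
  ... | inj₁ (_ , q)    = contradiction (sym (one-injective q)) (irreflexive j)
  ... | inj₂ (refl , _) = contradiction z< (<-irrefl refl)

  -- Separating the extra ends from the mandatory ones

  extrasX : Fin n → List ℕ
  extrasX i = when (last? (pos (slotX i 1F))) (pos (slotX i 1F))

  -- One end of each pair `v e` is mandatory, so offsets 2 and 6 are listed only when both letters
  -- of their pair are ends. Offsets 3 and 8 are always mandatory; the trailing `[]` belongs to the
  -- latter.
  extrasY : Fin m → List ℕ
  extrasY j = when (last? (y 0F)) (y 0F)
           ++ when (last? (y 1F) ×-dec last? (y 2F)) (y 2F)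
           ++ when (last? (y 4F)) (y 4F)
           ++ when (last? (y 5F) ×-dec last? (y 6F)) (y 6F)
           ++ when (last? (y 7F)) (y 7F)
           ++ []
    where
    y : Fin 9 → ℕ
    y o = pos (slotY j o)

  extrasC : ℕ → Fin ℓ → List ℕ
  extrasC i γ = hits last? (A i + toℕ γ * suc (A i)) (A i)

  -- The nesting, with the empty lists for the blocks of P, is that of the `surplus-++` sums in
  -- `surplus-all`.
  extras : ℕ → List ℕ
  extras zero    = ((concat (tabulate {n = n} λ _ → []) ++ concat (tabulate {n = m} λ _ → []))
                    ++ concat (tabulate extrasX)) ++ concat (tabulate extrasY)
  extras (suc i) = extras i ++ concat (tabulate (extrasC i))

  private
    f : ℕ → ℕ
    f = bit last?

    cell-one : ∀ g a → 1 ≤ g (a + 0) → Surplus g a 1 1 []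
    cell-one g a 1≤ = surplus (≤-trans 1≤ (m≤m+n _ 0))

    cell-two : ∀ g a → 1 ≤ g (a + 0) → 1 ≤ g (a + 1) → Surplus g a 2 2 []
    cell-two g a p q = surplus (+-mono-≤ p (≤-trans q (m≤m+n _ 0)))

    ticked : ∀ {y} → Last y → 1 ≤ f y
    ticked {y} = tick-yes (last? y)

    -- With base 0 the offsets inside a block are literals, so the cells of a Y-block can be joined
    -- without rewriting positions.
    rebase : ∀ {a l b xs} → Surplus (λ o → f (a + o)) 0 l b xs → Surplus f a l b xs
    rebase (surplus p) = surplus p

    surplusV : ∀ i → Surplus f (0 + baseV i) 2 2 []
    surplusV i = cell-two f (baseV i) (ticked (last-V0 i)) (ticked (only⇒last (slotV i 1F) (only-#p-V i)))

    surplusE : ∀ j → Surplus f (baseE j) 2 2 []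
    surplusE j = cell-two f (baseE j) (ticked (last-E0 j)) (ticked (only⇒last (slotE j 1F) (only-#p-E j)))

    surplusX : ∀ i → Surplus f (baseX i) 3 2 (extrasX i)
    surplusX i = surplus (≤-trans (≤-reflexive (+-comm 2 _))
      (≤-trans (+-mono-≤ (length-when (last? (pos (slotX i 1F))))
                 (+-mono-≤ (ticked (last-X0 i)) (ticked (only⇒last (slotX i 2F) (only-#v i)))))
        (≤-reflexive (rearrange (f (baseX i + 1)) (f (baseX i + 0)) (f (baseX i + 2))))))
      where
      rearrange : ∀ a b c → a + (b + c) ≡ b + (a + (c + 0))
      rearrange = solve-∀

    surplusY : ∀ j → Surplus f (baseY j) 9 4 (extrasY j)
    surplusY j = rebase (surplus-++ g 0 (free 0)
      (surplus-++ g 1 (pair 1 (last-Y1∨Y2 j))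
      (surplus-++ g 3 (cell-one g 3 (ticked (last-Y3 j)))
      (surplus-++ g 4 (free 4)
      (surplus-++ g 5 (pair 5 (last-Y5∨Y6 j))
      (surplus-++ g 7 (free 7)
        (cell-one g 8 (ticked (only⇒last (slotY j 8F) (only-#e j))))))))))
      where
      g : ℕ → ℕ
      g o = f (baseY j + o)
      at-offset : ∀ o → g (o + 0) ≡ tick (last? (baseY j + o))
      at-offset o = cong g (+-identityʳ o)
      free : ∀ o → Surplus g o 1 0 (when (last? (baseY j + o)) (baseY j + o))
      free o = surplus (≤-trans (length-when (last? (baseY j + o)))
        (≤-reflexive (sym (trans (+-identityʳ _) (at-offset o)))))
      pair : ∀ o → Last (baseY j + o) ⊎ Last (baseY j + (o + 1)) →
        Surplus g o 2 1 (when (last? (baseY j + o) ×-dec last? (baseY j + (o + 1))) (baseY j + (o + 1)))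
      pair o l = surplus (≤-trans (length-when-× (last? (baseY j + o)) (last? (baseY j + (o + 1))) l)
        (≤-reflexive (cong₂ _+_ (sym (at-offset o)) (sym (+-identityʳ _)))))

    surplusC : ∀ i → i < J → ∀ γ → Surplus f (A i + toℕ γ * suc (A i)) (suc (A i)) 1 (extrasC i γ)
    surplusC i i<J γ = subst₂ (λ l xs → Surplus f a l 1 xs) (+-comm (A i) 1) (List.++-identityʳ _)
      (surplus-++ f a (hits-surplus last? a (A i)) (cell-one f (a + A i) (ticked
        (subst Last (trans (sym (+-assoc (A i) _ _)) (sym (+-identityʳ _))) last-separator))))
      where
      a = A i + toℕ γ * suc (A i)
      y< : at i (toℕ γ) (A i) < A (suc i)
      y< = at-bound i γ ≤-refl
      low : ∀ {y} → y < A (suc i) → sG ! y ≡ α (suc i) ! y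
      low = α-prefix* J i<J
      last-separator : Last (at i (toℕ γ) (A i))
      last-separator = first⇒last (≤-trans y< (A-mono J i<J)) λ z< eq → <-irrefl
        (only-separator i γ (trans (sym (low (<-trans z< y<)))
          (trans eq (trans (low y<) (α-separator i γ))))) z<

    -- The summands belong to the vertex blocks of P, its edge blocks, X and Y; each higher level
    -- adds one end for each of its `ℓ` new separators.
    mandatory : ℕ → ℕ
    mandatory zero    = n * 2 + m * 2 + n * 2 + m * 4
    mandatory (suc i) = mandatory i + ℓ * 1

    surplus-all : ∀ i → i ≤ J → Surplus f 0 (A i) (mandatory i) (extras i)
    surplus-all zero _ = subst (λ l → Surplus f 0 l (mandatory 0) (extras 0)) (sym length-s1)
      (surplus-++ f 0 (surplus-++ f 0 (surplus-++ f 0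
        (surplus-blocks f 0 2 2 (λ _ → []) surplusV)
        (surplus-blocks f (n * 2) 2 2 (λ _ → []) surplusE))
        (surplus-blocks f (n * 2 + m * 2) 3 2 extrasX surplusX))
        (surplus-blocks f (n * 2 + m * 2 + n * 3) 9 4 extrasY surplusY))
    surplus-all (suc i) i<J = subst (λ l → Surplus f 0 l (mandatory (suc i)) (extras (suc i))) (sym (A-suc i))
      (surplus-++ f 0 (surplus-all i (<⇒≤ i<J))
        (surplus-blocks f (A i) (suc (A i)) 1 (extrasC i) (surplusC i i<J)))

    mandatory-total : ∀ i → mandatory i ≡ 4 * n + 6 * m + ℓ * i
    mandatory-total zero    = total n m ℓ
      where total : ∀ n m ℓ → n * 2 + m * 2 + n * 2 + m * 4 ≡ 4 * n + 6 * m + ℓ * 0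
            total = solve-∀
    mandatory-total (suc i) = trans (cong (_+ ℓ * 1) (mandatory-total i)) (step (4 * n + 6 * m) ℓ i)
      where step : ∀ a ℓ i → a + ℓ * i + ℓ * 1 ≡ a + ℓ * suc i
            step = solve-∀

  length-extras : length (extras J) ≤ k
  length-extras = +-cancelˡ-≤ (mandatory J) _ _ (begin
    mandatory J + length (extras J)   ≤⟨ Surplus.paid (surplus-all J ≤-refl) ⟩
    cnt f (A J)                       ≤⟨ lasts≤length ps (A J) ⟩
    length ps                         ≡⟨ size ⟩
    4 * n + 6 * m + k + ℓ * J         ≡⟨ swap (4 * n + 6 * m) k (ℓ * J) ⟩
    4 * n + 6 * m + ℓ * J + k         ≡⟨ cong (_+ k) (sym (mandatory-total J)) ⟩
    mandatory J + k                   ∎)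
    where
    open ≤-Reasoning
    swap : ∀ a b c → a + b + c ≡ a + c + b
    swap = solve-∀

  extras-mono : ∀ j {i y} → i ≤ j → y ∈ˡ extras i → y ∈ˡ extras j
  extras-mono zero    z≤n y∈ = y∈
  extras-mono (suc j) i≤  y∈ with m≤n⇒m<n∨m≡n i≤
  ... | inj₂ refl      = y∈
  ... | inj₁ (s≤s i≤j) = Mem.∈-++⁺ˡ (extras-mono j i≤j y∈)

  X-extra : ∀ i → Last (pos (slotX i 1F)) → pos (slotX i 1F) ∈ˡ extras J
  X-extra i l = extras-mono J z≤n (Mem.∈-++⁺ˡ (Mem.∈-++⁺ʳ
    (concat (tabulate {n = n} λ _ → []) ++ concat (tabulate {n = m} λ _ → []))
    (∈-blocks extrasX i (∈-when (last? (pos (slotX i 1F))) l))))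

  private
    Y-extra : ∀ j {y} → y ∈ˡ extrasY j → y ∈ˡ extras J
    Y-extra j y∈ = extras-mono J z≤n (Mem.∈-++⁺ʳ
      ((concat (tabulate {n = n} λ _ → []) ++ concat (tabulate {n = m} λ _ → [])) ++ concat (tabulate extrasX))
      (∈-blocks extrasY j y∈))

    skip : ∀ {Q : Set} (d : Dec Q) {y z} {zs : List ℕ} → z ∈ˡ zs → z ∈ˡ when d y ++ zs
    skip d {y} = Mem.∈-++⁺ʳ (when d y)

    take : ∀ {Q : Set} (d : Dec Q) {y} {zs : List ℕ} → Q → y ∈ˡ when d y ++ zs
    take d q = Mem.∈-++⁺ˡ (∈-when d q)

  module _ (j : Fin m) where

    private
      d : ∀ o → Dec (Last (baseY j + o))
      d o = last? (baseY j + o)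

    Y0-extra : Last (pos (slotY j 0F)) → pos (slotY j 0F) ∈ˡ extras J
    Y0-extra l = Y-extra j (take (d 0) l)

    Y2-extra : Last (pos (slotY j 1F)) → Last (pos (slotY j 2F)) → pos (slotY j 2F) ∈ˡ extras J
    Y2-extra l l′ = Y-extra j (skip (d 0) (take (d 1 ×-dec d 2) (l , l′)))

    Y4-extra : Last (pos (slotY j 4F)) → pos (slotY j 4F) ∈ˡ extras J
    Y4-extra l = Y-extra j (skip (d 0) (skip (d 1 ×-dec d 2) (take (d 4) l)))

    Y6-extra : Last (pos (slotY j 5F)) → Last (pos (slotY j 6F)) → pos (slotY j 6F) ∈ˡ extras J
    Y6-extra l l′ = Y-extra j (skip (d 0) (skip (d 1 ×-dec d 2) (skip (d 4) (take (d 5 ×-dec d 6) (l , l′)))))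

    Y7-extra : Last (pos (slotY j 7F)) → pos (slotY j 7F) ∈ˡ extras J
    Y7-extra l = Y-extra j (skip (d 0) (skip (d 1 ×-dec d 2) (skip (d 4) (skip (d 5 ×-dec d 6) (take (d 7) l)))))

  -- Beyond `s1` the only ends that are not listed are the separators closing the copies. Such a
  -- separator is a first occurrence, which the equal letter at `z` excludes.
  copy-extra : ∀ {y z} → A 0 ≤ y → y < A J → z < y → sG ! z ≡ sG ! y → Last y → y ∈ˡ extras J
  copy-extra {y} {z} A≤ y< z< eq l = go J y< eq
    where
    go : ∀ i → y < A i → α i ! z ≡ α i ! y → y ∈ˡ extras i
    go zero    y< _  = contradiction y< (≤⇒≯ A≤)
    go (suc i) y< eq with α-view i y<
    ... | prefix y<A = Mem.∈-++⁺ˡ (go i y<A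
      (trans (sym (α-prefix i (<-trans z< y<A))) (trans eq (α-prefix i y<A))))
    ... | copy γ {o} o< refl = Mem.∈-++⁺ʳ (extras i) (∈-blocks (extrasC i) γ
      (subst (_∈ˡ extrasC i γ) (+-assoc (A i) _ o)
        (∈-hits last? o< (subst Last (sym (+-assoc (A i) _ o)) l))))
    ... | separator γ refl = contradiction z< (<-irrefl (only-separator i γ (trans eq (α-separator i γ))))

  private

    -- Vertices read off the extra ends

    fin? : ∀ {N} → ℕ → Maybe (Fin N)
    fin? zero = nothing
    fin? {N} (suc i) with i <? N
    ... | yes i<N = just (Fin.fromℕ< i<N)
    ... | no  _   = nothing

    fin?-one : ∀ {N} (i : Fin N) → fin? (one i) ≡ just i
    fin?-one {N} i with toℕ i <? N
    ... | yes i<N = cong just (Fin.fromℕ<-toℕ i i<N)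
    ... | no  i≮N = contradiction (Fin.toℕ<n i) i≮N

    -- Each extra end pays for at most one vertex. On `e` or `$` either endpoint would cover the
    -- edge, and the first is chosen.
    vertexOf : Sym → Maybe (Fin n)
    vertexOf (v' i) = fin? i
    vertexOf (v i)  = fin? i
    vertexOf (e j)  = Maybe.map fst (fin? j)
    vertexOf ($ j)  = Maybe.map fst (fin? j)
    vertexOf _      = nothing

    vertexAt : ℕ → Maybe (Fin n)
    vertexAt y = (sG ! y) Maybe.>>= vertexOf

  cover : List (Fin n)
  cover = mapMaybe vertexAt (extras J)

  length-cover : length cover ≤ k
  length-cover = ≤-trans (List.length-mapMaybe vertexAt (extras J)) length-extras

  private
    covered : ∀ {y x p} → y ∈ˡ extras J → sG ! y ≡ just x → vertexOf x ≡ just p → p ∈ˡ cover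
    covered y∈ at≡ vertex≡ = Any.mapMaybe⁺ vertexAt (extras J) (Any.map⁺ (lose y∈
      (subst (MAny.Any _) (sym (trans (cong (Maybe._>>= vertexOf) at≡) vertex≡)) (MAny.just refl))))

    edge-vertex : ∀ j → Maybe.map fst (fin? (one j)) ≡ just (fst j)
    edge-vertex j = cong (Maybe.map fst) (fin?-one j)

  -- If `z` lies in X, then `v'` is a mandatory end there and the end on the following `v` is the
  -- extra one. Anywhere else the letter `v'` has occurred before, so the end at `z` itself is
  -- extra.
  marked : ∀ {z p} → z < A J → Last z → Last (suc z) → sG ! z ≡ just (v' (one p)) → p ∈ˡ cover
  marked {z} {p} z< l l′ eq with z <? A 0
  ... | no z≮ = covered (copy-extra (≮⇒≥ z≮) z< (≤-trans (pos-bound (slotX p 0F)) (≮⇒≥ z≮))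
                  (trans (sG-at (slotX p 0F)) (sym eq)) l) eq (fin?-one p)
  ... | yes z<A with s1-find (sG-s1 z<A eq)
  ... | slotX i _ , refl , v'-X q with one-injective q
  ...   | refl = covered (X-extra i (subst Last (pos-suc (baseX i) 0) l′)) (sG-at (slotX i 1F)) (fin?-one i)
  marked _ l _ _ | yes _ | slotY j _ , refl , v'-Y₁ q with one-injective q
  ... | refl = covered (Y0-extra j l) (sG-at (slotY j 0F)) (fin?-one (fst j))
  marked _ l _ _ | yes _ | slotY j _ , refl , v'-Y₂ q with one-injective q
  ... | refl = covered (Y4-extra j l) (sG-at (slotY j 4F)) (fin?-one (snd j))

  Covered : Fin m → Set
  Covered j = fst j ∈ˡ cover ⊎ snd j ∈ˡ cover

  -- A pair v' v copied at hop-depth 1 is copied from two phrase ends.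
  copied-pair : ∀ {y y′ p} → y′ ≡ suc y → y′ < A J → ¬ Last y → ¬ Last y′ →
    Depth y 1 → Depth y′ 1 → sG ! y ≡ just (v' (one p)) → p ∈ˡ cover
  copied-pair refl y′< ¬l ¬l′ depth depth′ eq with pair-source y′< ¬l ¬l′
  ... | z , z< , eq′ , _ , lower , lower′ =
    marked (<-trans z< (<-trans (n<1+n _) y′<)) (hop-zero (lower depth)) (hop-zero (lower′ depth′)) (trans eq′ eq)

  -- Occurrences of a level with bounded hop-number, and the descent

  record Occurrence (i y h : ℕ) : Set where
    field
      reads : ∀ {o} → o < A i → sG ! (y + o) ≡ α i ! o
      depth : ∀ {o} → o < A i → Depth (y + o) h

    occ-bound : ∀ {o} → o < A i → y + o < A J
    occ-bound o< with !-total (α i) o<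
    ... | x , eq = !-bound sG (trans (reads o<) eq)

  open Occurrence

  -- Suppose `Y_j` contains no extra end and copies neither pair `v' v`. Then both letters `v` are
  -- ends and neither `e` is; the final case rules this out.
  edge-covered-at-0 : (∀ {y} → y < A 0 → Depth y 1) → ∀ j → Covered j
  edge-covered-at-0 depth j with last? (pos (slotY j 0F)) | last? (pos (slotY j 4F)) | last? (pos (slotY j 7F))
  ... | yes l0 | _      | _      = inj₁ (covered (Y0-extra j l0) (sG-at (slotY j 0F)) (fin?-one (fst j)))
  ... | no _   | yes l4 | _      = inj₂ (covered (Y4-extra j l4) (sG-at (slotY j 4F)) (fin?-one (snd j)))
  ... | no _   | no _   | yes l7 = inj₁ (covered (Y7-extra j l7) (sG-at (slotY j 7F)) (edge-vertex j))
  ... | no ¬l0 | no ¬l4 | no ¬l7 with last? (pos (slotY j 1F)) | last? (pos (slotY j 2F))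
  ...   | yes l1 | yes l2 = inj₁ (covered (Y2-extra j l1 l2) (sG-at (slotY j 2F)) (edge-vertex j))
  ...   | no ¬l1 | _ = inj₁ (copied-pair (+-suc (baseY j) 0)
    (≤-trans (pos-bound (slotY j 1F)) (A-mono J z≤n)) ¬l0 ¬l1
    (depth (pos-bound (slotY j 0F))) (depth (pos-bound (slotY j 1F))) (sG-at (slotY j 0F)))
  ...   | yes _ | no ¬l2 with last? (pos (slotY j 5F)) | last? (pos (slotY j 6F))
  ...     | yes l5 | yes l6 = inj₁ (covered (Y6-extra j l5 l6) (sG-at (slotY j 6F)) (edge-vertex j))
  ...     | no ¬l5 | _ = inj₂ (copied-pair (+-suc (baseY j) 4)
    (≤-trans (pos-bound (slotY j 5F)) (A-mono J z≤n)) ¬l4 ¬l5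
    (depth (pos-bound (slotY j 4F))) (depth (pos-bound (slotY j 5F))) (sG-at (slotY j 4F)))
  -- The `e $` at offsets 6 and 7 can only come from the one at offsets 2 and 3. Hop-number at most
  -- 1 would make offset 2 an end, against `¬l2`.
  ...     | yes _ | no ¬l6 with s1-pair-source {baseY j} {6} (pos-bound (slotY j 7F)) ¬l6 ¬l7
  ...       | z , z< , eq , eq′ , lower , _
    with e-$-adjacent (trans eq (s1-at (slotY j 6F))) (trans eq′ (s1-at (slotY j 7F)))
  ...         | inj₁ refl = contradiction (hop-zero (lower (depth (pos-bound (slotY j 6F))))) ¬l2
  ...         | inj₂ refl = contradiction z< (<-irrefl refl)

  module _ {y : ℕ} (occ : Occurrence 0 (suc y) 1) where

    later-reads : ∀ t → sG ! (suc y + pos t) ≡ just (letter t)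
    later-reads t = trans (reads occ (pos-bound t)) (s1-at t)

    -- The symbol #p of e_j, which precedes Y_j, occurs only once in s1.
    later-extra : ∀ j o → Last (suc y + pos (slotY j o)) → suc y + pos (slotY j o) ∈ˡ extras J
    later-extra j o = copy-extra
      (≤-trans beyond (+-monoʳ-≤ (suc y) (≤-trans (<⇒≤ (slotE-bound j 1F)) (≤-trans (m≤m+n _ _) (slotY-≥ j o)))))
      (occ-bound occ (pos-bound (slotY j o)))
      (m<n+m (pos (slotY j o)) {suc y} (s≤s z≤n))
      (trans (sG-at (slotY j o)) (sym (later-reads (slotY j o))))
      where
      beyond : A 0 ≤ suc y + pos (slotE j 1F)
      beyond = ≮⇒≥ λ lt → <-irrefl (sym (only-#p-E j (sG-s1 lt (later-reads (slotE j 1F)))))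
        (m<n+m (pos (slotE j 1F)) {suc y} (s≤s z≤n))

  -- Away from position 0 no end in `Y_j` is mandatory: one of its first two letters carries an
  -- extra end, or the two form a copied pair `v' v`.
  edge-covered : ∀ {y} → Occurrence 0 y 1 → ∀ j → Covered j
  edge-covered {zero}  occ j = edge-covered-at-0 (depth occ) j
  edge-covered {suc y} occ j with last? (suc y + pos (slotY j 0F)) | last? (suc y + pos (slotY j 1F))
  ... | yes l0 | _      = inj₁ (covered (later-extra occ j 0F l0) (later-reads occ (slotY j 0F)) (fin?-one (fst j)))
  ... | no _   | yes l1 = inj₁ (covered (later-extra occ j 1F l1) (later-reads occ (slotY j 1F)) (fin?-one (fst j)))
  ... | no ¬l0 | no ¬l1 = inj₁ (copied-pair
    (trans (cong (suc y +_) (+-suc (baseY j) 0)) (+-suc (suc y) _))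
    (occ-bound occ (pos-bound (slotY j 1F))) ¬l0 ¬l1
    (depth occ (pos-bound (slotY j 0F))) (depth occ (pos-bound (slotY j 1F)))
    (later-reads occ (slotY j 0F)))

  -- Some piece of the occurrence contains no phrase end, so it is copied as a
  -- whole: ℓ pieces containing ends would give ℓ extras.
  descend : ∀ {i y h} → i < J → Occurrence (suc i) y (suc h) → ∃ λ y′ → Occurrence i y′ h
  descend {i} {y} {h} i<J occ with Fin.all? (λ γ → anyUpTo? (λ o → last? (y + at i (toℕ γ) o)) (A i))
  -- An end taken from each piece lies beyond `s1` and repeats a letter of the initial `α i`, so
  -- `copy-extra` lists it; ends from different pieces are different positions.
  ... | yes ends = contradiction (≤-trans (injection⇒≤length (extras J) (λ γ → y + at i (toℕ γ) (offset γ)) injective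
      λ γ → copy-extra
        (≤-trans (A-mono i z≤n) (≤-trans (m≤m+n (A i) _) (m≤n+m _ y)))
        (occ-bound occ (at-bound i γ (<⇒≤ (offset< γ))))
        (≤-trans (offset< γ) (≤-trans (m≤m+n (A i) _) (m≤n+m _ y)))
        (trans (α-prefix* J (<⇒≤ i<J) (offset< γ)) (sym (copy-reads γ (offset< γ))))
        (proj₂ (proj₂ (ends γ))))
      length-extras) (<⇒≱ k<ℓ)
    where
    offset : Fin ℓ → ℕ
    offset γ = proj₁ (ends γ)
    offset< : ∀ γ → offset γ < A i
    offset< γ = proj₁ (proj₂ (ends γ))
    copy-reads : ∀ γ {o} → o < A i → sG ! (y + at i (toℕ γ) o) ≡ α i ! o
    copy-reads γ o< = trans (reads occ (at-bound i γ (<⇒≤ o<))) (α-copy i γ o<)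
    injective : ∀ {γ γ′} → y + at i (toℕ γ) (offset γ) ≡ y + at i (toℕ γ′) (offset γ′) → γ ≡ γ′
    injective {γ} {γ′} eq = Fin.toℕ-injective (block-injective (suc (A i)) (toℕ γ) (toℕ γ′)
      (m≤n⇒m≤1+n (offset< γ)) (m≤n⇒m≤1+n (offset< γ′)) (+-cancelˡ-≡ (A i) _ _ (+-cancelˡ-≡ y _ _ eq)))
  ... | no ¬ends with Fin.¬∀⟶∃¬ ℓ _ (λ γ → anyUpTo? (λ o → last? (y + at i (toℕ γ) o)) (A i)) ¬ends
  ...   | γ , ¬end = copied (A i ≟ 0)
    where
    x : ℕ
    x = y + at i (toℕ γ) 0
    x+ : ∀ o → x + o ≡ y + at i (toℕ γ) o
    x+ o = trans (+-assoc y _ o) (cong (y +_) (trans (+-assoc (A i) _ o)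
      (cong (A i +_) (cong (_+ o) (+-identityʳ _)))))
    not-last : ∀ {o} → o < A i → ¬ Last (x + o)
    not-last {o} o< l = ¬end (o , o< , subst Last (x+ o) l)
    x-reads : ∀ {o} → o < A i → sG ! (x + o) ≡ α i ! o
    x-reads {o} o< = trans (cong (sG !_) (x+ o)) (trans (reads occ (at-bound i γ (<⇒≤ o<))) (α-copy i γ o<))
    x-depth : ∀ {o} → o < A i → Depth (x + o) (suc h)
    x-depth {o} o< = subst (λ z → Depth z (suc h)) (sym (x+ o)) (depth occ (at-bound i γ (<⇒≤ o<)))
    x-inside : ∀ {o} → o < A i → x + o < A J
    x-inside {o} o< = subst (_< A J) (sym (x+ o)) (occ-bound occ (at-bound i γ (<⇒≤ o<)))
    copied : Dec (A i ≡ 0) → ∃ λ y′ → Occurrence i y′ h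
    -- An empty `α i` occurs everywhere, and there is no first letter whose phrase could be
    -- followed.
    copied (yes A≡0) = 0 , record
      { reads = λ o< → contradiction o< (subst (λ a → ¬ (_ < a)) (sym A≡0) λ ())
      ; depth = λ o< → contradiction o< (subst (λ a → ¬ (_ < a)) (sym A≡0) λ ()) }
    copied (no A≢0) with copies-or-last (x-inside (n≢0⇒n>0 A≢0)) (not-last (n≢0⇒n>0 A≢0))
    ... | a , L , b , t , copies , x+0≡ = b + t , record
      { reads = λ {o} o< → trans (cong (sG !_) (+-assoc b t o))
          (trans (copies-≡ (run o o<)) (trans (cong (sG !_) (sym (x+≡ o))) (x-reads o<)))
      ; depth = λ {o} o< → subst (λ z → Depth z h) (sym (+-assoc b t o))
          (hop-copies (run o o<) noOverlap (subst (λ z → Depth z (suc h)) (x+≡ o) (x-depth o<))) }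
      where
      x+≡ : ∀ o → x + o ≡ a + (t + o)
      x+≡ o = trans (cong (_+ o) (trans (sym (+-identityʳ x)) x+0≡)) (+-assoc a t o)
      run : ∀ o → o < A i → Copies a L b (t + o)
      run zero    _  = subst (Copies a L b) (sym (+-identityʳ t)) copies
      run (suc o) o< = subst (Copies a L b) (sym (+-suc t o)) (copies-next (run o (<-trans (n<1+n o) o<))
        (subst (¬_ ∘ Last) (trans (x+≡ (suc o)) (cong (a +_) (+-suc t o))) (not-last o<)))

  -- Level and hop bound fall in step. The whole string has level `c - 1` and bound `c`, so `s1` is
  -- reached with bound 1.
  descend-all : ∀ i → i ≤ J → ∀ {y} → Occurrence i y (suc i) → ∃ λ y′ → Occurrence 0 y′ 1
  descend-all zero    _   occ = _ , occ
  descend-all (suc i) i<J occ = descend-all i (<⇒≤ i<J) (proj₂ (descend i<J occ))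

  all-covered : ∀ j → Covered j
  all-covered = edge-covered (proj₂ (descend-all J ≤-refl {0} (record
    { reads = λ _ → refl ; depth = λ o< → proj₂ blz _ o< })))

-- From a vertex cover to a parsing

total : Parsing → ℕ
total []         = 0
total (ph ∷ ps) = len ph + total ps

total-++ : ∀ ps qs → total (ps ++ qs) ≡ total ps + total qs
total-++ []         qs = refl
total-++ (ph ∷ ps) qs = trans (cong (len ph +_) (total-++ ps qs)) (sym (+-assoc (len ph) _ _))

starts-++ : ∀ a ps qs → starts a (ps ++ qs) ≡ starts a ps ++ starts (a + total ps) qs
starts-++ a []         qs = cong (λ a → starts a qs) (sym (+-identityʳ a))
starts-++ a (ph ∷ ps) qs = cong ((a , ph) ∷_) (trans (starts-++ (a + len ph) ps qs)
  (cong (λ a′ → starts (a + len ph) ps ++ starts a′ qs) (+-assoc a _ _)))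

-- As starts (base + o), but literal offsets o compute.
offsets : ℕ → ℕ → Parsing → List (ℕ × Phrase)
offsets base o []         = []
offsets base o (ph ∷ ps) = (base + o , ph) ∷ offsets base (o + len ph) ps

offsets≡starts : ∀ base o ps → offsets base o ps ≡ starts (base + o) ps
offsets≡starts base o []         = refl
offsets≡starts base o (ph ∷ ps) = cong ((base + o , ph) ∷_)
  (trans (offsets≡starts base (o + len ph) ps) (cong (λ a → starts a ps) (sym (+-assoc base o _))))

offsets₀≡starts : ∀ base ps → offsets base 0 ps ≡ starts base ps
offsets₀≡starts base ps = trans (offsets≡starts base 0 ps) (cong (λ a → starts a ps) (+-identityʳ base))

module _ (w : ℕ) where

  total-blocks : ∀ {n} (f : Fin n → Parsing) → (∀ i → total (f i) ≡ w) →
                 total (concat (tabulate f)) ≡ n * w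
  total-blocks {zero}  f eq = refl
  total-blocks {suc n} f eq = trans (total-++ (f zero) _) (cong₂ _+_ (eq zero) (total-blocks (f ∘ suc) (eq ∘ suc)))

  private
    split : ∀ {n} (f : Fin (suc n) → Parsing) → total (f zero) ≡ w → ∀ a →
      starts a (concat (tabulate f)) ≡ starts a (f zero) ++ starts (a + w) (concat (tabulate (f ∘ suc)))
    split f eq a = trans (starts-++ a (f zero) _)
      (cong (λ w → starts a (f zero) ++ starts (a + w) (concat (tabulate (f ∘ suc)))) eq)

  All-blocks : ∀ {Q : ℕ × Phrase → Set} {n} (f : Fin n → Parsing) a → (∀ i → total (f i) ≡ w) →
    (∀ i → All Q (starts (a + toℕ i * w) (f i))) → All Q (starts a (concat (tabulate f)))
  All-blocks {n = zero}  f a eq qs = []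
  All-blocks {Q} {n = suc n} f a eq qs = subst (All Q) (sym (split f (eq zero) a)) (All.++⁺
    (subst (λ a → All Q (starts a (f zero))) (+-identityʳ a) (qs zero))
    (All-blocks (f ∘ suc) (a + w) (eq ∘ suc) λ i →
      subst (λ a → All Q (starts a (f (suc i)))) (sym (+-assoc a w _)) (qs (suc i))))

  ∈-starts-blocks : ∀ {n x} (f : Fin n → Parsing) a → (∀ i → total (f i) ≡ w) →
    ∀ i → x ∈ˡ starts (a + toℕ i * w) (f i) → x ∈ˡ starts a (concat (tabulate f))
  ∈-starts-blocks {x = x} f a eq zero x∈ = subst (x ∈ˡ_) (sym (split f (eq zero) a))
    (Mem.∈-++⁺ˡ (subst (λ a → x ∈ˡ starts a (f zero)) (+-identityʳ a) x∈))
  ∈-starts-blocks {x = x} f a eq (suc i) x∈ = subst (x ∈ˡ_) (sym (split f (eq zero) a))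
    (Mem.∈-++⁺ʳ (starts a (f zero)) (∈-starts-blocks (f ∘ suc) (a + w) (eq ∘ suc) i
      (subst (λ a → x ∈ˡ starts a (f (suc i))) (sym (+-assoc a w _)) x∈)))

ValidFrom-All : ∀ {s} a ps → All (λ { (a , ph) → PhraseOK s a ph }) (starts a ps) →
                a + total ps ≡ length s → ValidFrom s a ps
ValidFrom-All a []         []         eq = trans (sym (+-identityʳ a)) eq
ValidFrom-All a (ph ∷ ps) (ok ∷ oks) eq = ok , ValidFrom-All (a + len ph) ps oks (trans (+-assoc a _ _) eq)

length-blocks-∈ : ∀ {A : Set} {n} (C : Subset n) (f : Fin n → List A) b →
  (∀ {i} → i ∈ˢ C → length (f i) ≡ suc b) → (∀ {i} → ¬ i ∈ˢ C → length (f i) ≡ b) →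
  length (concat (tabulate f)) ≡ n * b + ∣ C ∣
length-blocks-∈ []            f b in-C out-C = refl
length-blocks-∈ (inside ∷ C)  f b in-C out-C = trans (List.length-++ (f zero)) (trans
  (cong₂ _+_ (in-C here) (length-blocks-∈ C (f ∘ suc) b (in-C ∘ there) (λ ∉ → out-C (∉ ∘ drop-there))))
  (rearrange b _ ∣ C ∣))
  where rearrange : ∀ b x y → suc b + (x + y) ≡ b + x + suc y
        rearrange = solve-∀
length-blocks-∈ (outside ∷ C) f b in-C out-C = trans (List.length-++ (f zero)) (trans
  (cong₂ _+_ (out-C λ ()) (length-blocks-∈ C (f ∘ suc) b (in-C ∘ there) (λ ∉ → out-C (∉ ∘ drop-there))))
  (sym (+-assoc b _ _)))

pattern literal = phrase 1 nothing
pattern copied L b = phrase L (just b)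

-- The parsing attached to a cover

module Forward {n m : ℕ} (G : Graph n m) (J ℓ : ℕ) (C : Subset n)
  (C-covers : ∀ j → proj₁ (edge G j) ∈ˢ C ⊎ proj₂ (edge G j) ∈ˢ C) where

  open Overlap G (suc J) ℓ
  open Layout G (suc J) ℓ

  -- The third phrase makes `v` an end beside `v'`, so that the whole pair can be copied in one hop.
  -- Without it, `v` is copied from P and `#v` closes the phrase.
  phrasesX : ∀ i → Dec (i ∈ˢ C) → Parsing
  phrasesX i (yes _) = literal ∷ literal ∷ literal ∷ []
  phrasesX i (no _)  = literal ∷ copied 2 (pos (slotV i 0F)) ∷ []

  -- The half whose vertex is known to be in `C` copies `v' v` and ends on `e`; the other half
  -- copies `v'` and ends on `v`. The ends fall on offsets 2, 3, 5, 8 or on 1, 3, 6, 8, and the last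
  -- phrase copies `e $`, respectively `$`, from ends of the same block. Every source is thus an
  -- end.
  phrasesY : ∀ j → fst j ∈ˢ C ⊎ snd j ∈ˢ C → Parsing
  phrasesY j (inj₁ _) = copied 3 (pos (slotX (fst j) 0F)) ∷ literal ∷
    copied 2 (pos (slotX (snd j) 0F)) ∷ copied 3 (pos (slotY j 2F)) ∷ []
  phrasesY j (inj₂ _) = copied 2 (pos (slotX (fst j) 0F)) ∷ copied 2 (pos (slotE j 0F)) ∷
    copied 3 (pos (slotX (snd j) 0F)) ∷ copied 2 (pos (slotY j 3F)) ∷ []

  -- α 0 is empty when n = m = 0, and then there is nothing to copy.
  piecePhrase : ℕ → Phrase
  piecePhrase zero    = literal
  piecePhrase (suc a) = copied (suc (suc a)) 0

  blockV : Fin n → Parsing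
  blockV i = literal ∷ literal ∷ []

  blockE : Fin m → Parsing
  blockE j = literal ∷ literal ∷ []

  blockX : Fin n → Parsing
  blockX i = phrasesX i (i ∈? C)

  blockY : Fin m → Parsing
  blockY j = phrasesY j (C-covers j)

  blockC : ℕ → Fin ℓ → Parsing
  blockC i γ = [ piecePhrase (A i) ]

  parsing : ℕ → Parsing
  parsing zero    = ((concat (tabulate blockV) ++ concat (tabulate blockE)) ++ concat (tabulate blockX))
                    ++ concat (tabulate blockY)
  parsing (suc i) = parsing i ++ concat (tabulate (blockC i))

  private
    total-X : ∀ i → total (blockX i) ≡ 3
    total-X i with i ∈? C
    ... | yes _ = refl
    ... | no  _ = refl

    total-Y : ∀ j → total (blockY j) ≡ 9
    total-Y j with C-covers j
    ... | inj₁ _ = refl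
    ... | inj₂ _ = refl

    total-C : ∀ i γ → total (blockC i γ) ≡ suc (A i)
    total-C i γ with A i
    ... | zero  = refl
    ... | suc a = +-identityʳ _

    VE VEX : Parsing
    VE  = concat (tabulate blockV) ++ concat (tabulate blockE)
    VEX = VE ++ concat (tabulate blockX)

    total-V : total (concat (tabulate blockV)) ≡ n * 2
    total-V = total-blocks 2 blockV (λ _ → refl)

    total-VE : total VE ≡ n * 2 + m * 2
    total-VE = trans (total-++ (concat (tabulate blockV)) _) (cong₂ _+_ total-V (total-blocks 2 blockE (λ _ → refl)))

    total-VEX : total VEX ≡ n * 2 + m * 2 + n * 3
    total-VEX = trans (total-++ VE _) (cong₂ _+_ total-VE (total-blocks 3 blockX total-X))

  total-parsing : ∀ i → total (parsing i) ≡ A i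
  total-parsing zero    = trans (total-++ VEX _)
    (trans (cong₂ _+_ total-VEX (total-blocks 9 blockY total-Y)) (sym length-s1))
  total-parsing (suc i) = trans (total-++ (parsing i) _)
    (trans (cong₂ _+_ (total-parsing i) (total-blocks (suc (A i)) (blockC i) (total-C i))) (sym (A-suc i)))

  private
    starts-parts : ∀ {a} ps qs → total ps ≡ a → starts 0 (ps ++ qs) ≡ starts 0 ps ++ starts a qs
    starts-parts ps qs refl = starts-++ 0 ps qs

    weaken : ∀ {a x} ps qs → total ps ≡ a → x ∈ˡ starts 0 ps → x ∈ˡ starts 0 (ps ++ qs)
    weaken ps qs eq x∈ = subst (_ ∈ˡ_) (sym (starts-parts ps qs eq)) (Mem.∈-++⁺ˡ x∈)

    append : ∀ {a x} ps qs → total ps ≡ a → x ∈ˡ starts a qs → x ∈ˡ starts 0 (ps ++ qs)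
    append ps qs eq x∈ = subst (_ ∈ˡ_) (sym (starts-parts ps qs eq)) (Mem.∈-++⁺ʳ (starts 0 ps) x∈)

    All-parts : ∀ {Q : ℕ × Phrase → Set} {a} ps qs → total ps ≡ a →
      All Q (starts 0 ps) → All Q (starts a qs) → All Q (starts 0 (ps ++ qs))
    All-parts {Q} ps qs eq p q = subst (All Q) (sym (starts-parts ps qs eq)) (All.++⁺ p q)

    lift : ∀ i {x} → x ∈ˡ starts 0 (parsing 0) → x ∈ˡ starts 0 (parsing i)
    lift zero    x∈ = x∈
    lift (suc i) x∈ = weaken (parsing i) _ refl (lift i x∈)

    in-V : ∀ i {x} → x ∈ˡ offsets (baseV i) 0 (blockV i) → x ∈ˡ starts 0 (parsing J)
    in-V i {x} x∈ = lift J (weaken VEX _ refl (weaken VE _ refl (weaken (concat (tabulate blockV)) _ refl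
      (∈-starts-blocks 2 blockV 0 (λ _ → refl) i (subst (x ∈ˡ_) (offsets₀≡starts _ (blockV i)) x∈)))))

    in-E : ∀ j {x} → x ∈ˡ offsets (baseE j) 0 (blockE j) → x ∈ˡ starts 0 (parsing J)
    in-E j {x} x∈ = lift J (weaken VEX _ refl (weaken VE _ refl (append (concat (tabulate blockV)) _ total-V
      (∈-starts-blocks 2 blockE (n * 2) (λ _ → refl) j (subst (x ∈ˡ_) (offsets₀≡starts _ (blockE j)) x∈)))))

    in-X : ∀ i {x} → x ∈ˡ offsets (baseX i) 0 (blockX i) → x ∈ˡ starts 0 (parsing J)
    in-X i {x} x∈ = lift J (weaken VEX _ refl (append VE _ total-VE
      (∈-starts-blocks 3 blockX _ total-X i (subst (x ∈ˡ_) (offsets₀≡starts _ (blockX i)) x∈))))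

    -- The choice `c` is a separate argument, so that callers can fix which of the two parsings of
    -- `Y_j` is meant.
    in-Y : ∀ j {c x} → C-covers j ≡ c → x ∈ˡ offsets (baseY j) 0 (phrasesY j c) → x ∈ˡ starts 0 (parsing J)
    in-Y j {x = x} refl x∈ = lift J (append VEX _ total-VEX
      (∈-starts-blocks 9 blockY _ total-Y j (subst (x ∈ˡ_) (offsets₀≡starts _ (blockY j)) x∈)))

  Last : ℕ → Set
  Last = IsLast (parsing J)

  private
    ends : ∀ {base o L src′} → (base + o , phrase (suc L) src′) ∈ˡ starts 0 (parsing J) → Last (base + (o + L))
    ends {base} {o} {L} x∈ = lose x∈ (s≤s z≤n , trans (sym (+-assoc base o L)) (sym (+∸1 (base + o) (s≤s z≤n))))

  last-V0 : ∀ i → Last (pos (slotV i 0F))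
  last-V0 i = ends {o = 0} {0} (in-V i (here refl))

  last-E0 : ∀ j → Last (pos (slotE j 0F))
  last-E0 j = ends {o = 0} {0} (in-E j (here refl))

  last-X0 : ∀ i → Last (pos (slotX i 0F))
  last-X0 i = ends {o = 0} {0} (in-X i first)
    where
    first : (baseX i + 0 , literal) ∈ˡ offsets (baseX i) 0 (blockX i)
    first with i ∈? C
    ... | yes _ = here refl
    ... | no  _ = here refl

  last-X1 : ∀ {i} → i ∈ˢ C → Last (pos (slotX i 1F))
  last-X1 {i} i∈C = ends {o = 1} {0} (in-X i second)
    where
    second : (baseX i + 1 , literal) ∈ˡ offsets (baseX i) 0 (blockX i)
    second with i ∈? C
    ... | yes _   = there (here refl)
    ... | no  i∉C = contradiction i∈C i∉C

  -- Sources and hop-numbers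

  Shallow : ℕ → ℕ → Set
  Shallow a q = Last q ⊎ ∃ λ i → A i ≤ a × q < A i

  -- `b + L ≤ suc a` keeps the `L - 1` copied letters before the phrase, so the modulus in the
  -- source position is trivial. `Shallow` records why a source has a small hop-number: it is an
  -- end, or it lies in some `α i` that is complete before the phrase begins.
  Good : ℕ × Phrase → Set
  Good (a , phrase L nothing)  = L ≡ 1
  Good (a , phrase L (just b)) = 1 ≤ L × b < a × b + L ≤ suc a ×
    (∀ t → suc t < L → sG ! (b + t) ≡ sG ! (a + t) × Shallow a (b + t))

  private
    Agree : ℕ → ℕ → Set
    Agree q y = sG ! q ≡ sG ! y × Last q

    agree : ∀ t t′ → letter t ≡ letter t′ → Last (pos t) → Agree (pos t) (pos t′)
    agree t t′ eq l = trans (at-slot t) (trans (cong just eq) (sym (at-slot t′))) , l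
      where at-slot : ∀ t → sG ! pos t ≡ just (letter t)
            at-slot t = trans (α-prefix* J z≤n (pos-bound t)) (s1-at t)

    copy₂ : ∀ {q y} → q < y → Agree q y → Good (y , copied 2 q)
    copy₂ {q} {y} q<y (eq , l) = s≤s z≤n , q<y , subst (_≤ suc y) (+-comm 2 q) (s≤s q<y) , λ
      { zero _ → subst₂ (λ q y → sG ! q ≡ sG ! y) (sym (+-identityʳ q)) (sym (+-identityʳ y)) eq ,
                 inj₁ (subst Last (sym (+-identityʳ q)) l)
      ; (suc _) (s≤s (s≤s ())) }

    copy₃ : ∀ b o a o′ → b + suc o < a + o′ → Agree (b + o) (a + o′) → Agree (b + suc o) (a + suc o′) →
            Good (a + o′ , copied 3 (b + o))
    copy₃ b o a o′ q<y (eq , l) (eq′ , l′) = s≤s z≤n , <-trans (+-monoʳ-< b (n<1+n o)) q<y ,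
      subst (_≤ suc (a + o′)) (trans (cong (2 +_) (+-suc b o)) (+-comm 3 (b + o))) (s≤s q<y) , λ
      { zero _ → subst₂ (λ q y → sG ! q ≡ sG ! y) (sym (+-identityʳ _)) (sym (+-identityʳ _)) eq ,
                 inj₁ (subst Last (sym (+-identityʳ _)) l)
      ; (suc zero) _ → subst₂ (λ q y → sG ! q ≡ sG ! y) (step b o) (step a o′) eq′ ,
                 inj₁ (subst Last (step b o) l′)
      ; (suc (suc _)) (s≤s (s≤s (s≤s ()))) }
      where
      step : ∀ a o → a + suc o ≡ a + o + 1
      step a o = trans (+-suc a o) (+-comm 1 (a + o))

  last-Y3 : ∀ j → Last (pos (slotY j 3F))
  last-Y3 j with C-covers j in eq
  ... | inj₁ _ = ends {o = 3} {0} (in-Y j eq (there (here refl)))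
  ... | inj₂ _ = ends {o = 2} {1} (in-Y j eq (there (here refl)))

  last-Y2 : ∀ j {p} → C-covers j ≡ inj₁ p → Last (pos (slotY j 2F))
  last-Y2 j eq = ends {o = 0} {2} (in-Y j eq (here refl))

  good-X : ∀ i → All Good (offsets (baseX i) 0 (blockX i))
  good-X i with i ∈? C
  ... | yes _ = refl ∷ refl ∷ refl ∷ []
  ... | no  _ = refl ∷ copy₂ (≤-trans (slotV-bound i 0F) (≤-trans (m≤m+n _ _) (slotX-≥ i 1F)))
                        (agree (slotV i 0F) (slotX i 1F) refl (last-V0 i)) ∷ []

  private
    X<Y : ∀ i o j o′ → pos (slotX i o) < pos (slotY j o′)
    X<Y i o j o′ = ≤-trans (slotX-bound i o) (slotY-≥ j o′)

    Y<Y : ∀ j {o o′} → o < o′ → baseY j + o < baseY j + o′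
    Y<Y j = +-monoʳ-< (baseY j)

  good-Y : ∀ j → All Good (offsets (baseY j) 0 (blockY j))
  good-Y j with C-covers j in eq
  ... | inj₁ p∈C =
      copy₃ (baseX (fst j)) 0 (baseY j) 0 (X<Y (fst j) 1F j 0F)
        (agree (slotX (fst j) 0F) (slotY j 0F) refl (last-X0 (fst j)))
        (agree (slotX (fst j) 1F) (slotY j 1F) refl (last-X1 p∈C))
    ∷ refl
    ∷ copy₂ (X<Y (snd j) 0F j 4F) (agree (slotX (snd j) 0F) (slotY j 4F) refl (last-X0 (snd j)))
    ∷ copy₃ (baseY j) 2 (baseY j) 6 (Y<Y j (s≤s (s≤s (s≤s (s≤s z≤n)))))
        (agree (slotY j 2F) (slotY j 6F) refl (last-Y2 j eq))
        (agree (slotY j 3F) (slotY j 7F) refl (last-Y3 j))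
    ∷ []
  ... | inj₂ q∈C =
      copy₂ (X<Y (fst j) 0F j 0F) (agree (slotX (fst j) 0F) (slotY j 0F) refl (last-X0 (fst j)))
    ∷ copy₂ (≤-trans (slotE-bound j 0F) (≤-trans (m≤m+n _ _) (slotY-≥ j 2F)))
        (agree (slotE j 0F) (slotY j 2F) refl (last-E0 j))
    ∷ copy₃ (baseX (snd j)) 0 (baseY j) 4 (X<Y (snd j) 1F j 4F)
        (agree (slotX (snd j) 0F) (slotY j 4F) refl (last-X0 (snd j)))
        (agree (slotX (snd j) 1F) (slotY j 5F) refl (last-X1 q∈C))
    ∷ copy₂ (Y<Y j (s≤s (s≤s (s≤s (s≤s z≤n))))) (agree (slotY j 3F) (slotY j 7F) refl (last-Y3 j))
    ∷ []

  good-C : ∀ i → i < J → ∀ γ → Good (A i + toℕ γ * suc (A i) , piecePhrase (A i))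
  good-C i i<J γ = go (A i) refl
    where
    a = A i + toℕ γ * suc (A i)
    -- `A i` is generalised to `l` so that `piecePhrase` computes. The phrase is one letter longer
    -- than `α i` and ends on the separator.
    go : ∀ l → l ≡ A i → Good (a , piecePhrase l)
    go zero    _   = refl
    go (suc l) l≡A = s≤s z≤n , ≤-trans (subst (0 <_) l≡A (s≤s z≤n)) (m≤m+n (A i) _) ,
      s≤s (≤-trans (≤-reflexive l≡A) (m≤m+n (A i) _)) , λ t t< →
        let t<A = subst (t <_) l≡A (≤-pred t<) in
        trans (α-prefix* J (<⇒≤ i<J) t<A) (sym (trans (cong (sG !_) (+-assoc (A i) _ t))
          (trans (α-prefix* J i<J (at-bound i γ (<⇒≤ t<A))) (α-copy i γ t<A)))) ,
        inj₂ (i , m≤m+n (A i) _ , t<A)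

  private
    from-offsets : ∀ {base} ps → All Good (offsets base 0 ps) → All Good (starts base ps)
    from-offsets {base} ps = subst (All Good) (offsets₀≡starts base ps)

  all-good : ∀ i → i ≤ J → All Good (starts 0 (parsing i))
  all-good zero _ = All-parts VEX _ total-VEX
    (All-parts VE _ total-VE
      (All-parts (concat (tabulate blockV)) _ total-V
        (All-blocks 2 blockV 0 (λ _ → refl) λ _ → refl ∷ refl ∷ [])
        (All-blocks 2 blockE _ (λ _ → refl) λ _ → refl ∷ refl ∷ []))
      (All-blocks 3 blockX _ total-X λ i → from-offsets (blockX i) (good-X i)))
    (All-blocks 9 blockY _ total-Y λ j → from-offsets (blockY j) (good-Y j))
  all-good (suc i) i<J = All-parts (parsing i) _ (total-parsing i) (all-good i (<⇒≤ i<J))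
    (All-blocks (suc (A i)) (blockC i) (A i) (total-C i) λ γ → good-C i i<J γ ∷ [])

  good⇒ok : ∀ {a ph} → Good (a , ph) → PhraseOK sG a ph
  good⇒ok {ph = phrase _ nothing}  L≡1 = L≡1
  good⇒ok {ph = phrase _ (just _)} (1≤L , b<a , _ , good) = 1≤L , b<a , λ t t< → proj₁ (good t t<)

  valid : IsLZParsing sG (parsing J)
  valid = ValidFrom-All 0 (parsing J) (All.map good⇒ok (all-good J ≤-refl)) (total-parsing J)

  open Parse {sG} {parsing J} valid

  no-wrap : ∀ {a L b t} → b < a → b + L ≤ suc a → suc t < L → t % suc (a ∸ suc b) ≡ t
  no-wrap {a} {L} {b} {t} b<a b+L≤ t< = m<n⇒m%n≡m (+-cancelˡ-≤ (suc b) _ _ (begin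
    suc b + suc t             ≡⟨ sym (+-suc b (suc t)) ⟩
    b + suc (suc t)           ≤⟨ +-monoʳ-≤ b t< ⟩
    b + L                     ≤⟨ b+L≤ ⟩
    suc a                     ≡⟨ cong suc (sym (m+[n∸m]≡n b<a)) ⟩
    suc (suc b + (a ∸ suc b)) ≡⟨ sym (+-suc (suc b) _) ⟩
    suc b + suc (a ∸ suc b)   ∎))
    where open ≤-Reasoning

  -- Each level adds one hop to the level it copies; phrases of `s1` copy ends only, which gives the
  -- bound 1 at the bottom.
  hops : ∀ i → i ≤ J → ∀ {y} → y < A i → HopAtMost (parsing J) y (suc i)
  hops i i≤J {y} y< with isLast? (parsing J) y
  ... | yes last = 0 , hop-last last , z≤n
  ... | no ¬last with copies-or-last (≤-trans y< (A-mono J i≤J)) ¬last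
  ...   | a , L , b , t , (x∈ , t<) , refl with All.lookup (all-good J ≤-refl) x∈
  ...     | _ , b<a , b+L≤ , good = through i i≤J y< (proj₂ (good t t<))
    where
    source : SourceOf (parsing J) (a + t) (b + t)
    source = lose x∈ (b , refl , b<a , t , t< , refl , cong (b +_) (sym (no-wrap b<a b+L≤ t<)))
    via : ∀ {h} → HopAtMost (parsing J) (b + t) h → HopAtMost (parsing J) (a + t) (suc h)
    via (h , hop , h≤) = suc h , hop-src ¬last source hop , s≤s h≤
    through : ∀ i → i ≤ J → a + t < A i → Shallow a (b + t) → HopAtMost (parsing J) (a + t) (suc i)
    through i _ _ (inj₁ last) with via (0 , hop-last last , z≤n)
    ... | h , hop , h≤ = h , hop , ≤-trans h≤ (s≤s z≤n)
    -- The phrase starts no earlier than `A i′`, whereas `a + t < A i`; hence `i′ < i`, and the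
    -- source lies in a lower level.
    through i i≤J y< (inj₂ (i′ , A≤a , q<)) with i ≤? i′
    ... | yes i≤i′ = contradiction y< (≤⇒≯ (≤-trans (A-mono i′ i≤i′) (≤-trans A≤a (m≤m+n a t))))
    through zero    _   _  (inj₂ (i′ , A≤a , q<)) | no i≰i′ = contradiction z≤n i≰i′
    through (suc i) i<J _  (inj₂ (i′ , A≤a , q<)) | no i≰i′ =
      via (hops i (<⇒≤ i<J) (≤-trans q< (A-mono i (≤-pred (≰⇒> i≰i′)))))

  is-BLZ : IsBLZ (suc J) sG (parsing J)
  is-BLZ = valid , λ p p< → hops J ≤-refl p<

  private

    -- Size of the parsing

    length-X : length (concat (tabulate blockX)) ≡ n * 2 + ∣ C ∣
    length-X = length-blocks-∈ C blockX 2 (λ {i} → in-C i) (λ {i} → out-C i)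
      where
      in-C : ∀ i → i ∈ˢ C → length (blockX i) ≡ 3
      in-C i i∈C with i ∈? C
      ... | yes _   = refl
      ... | no  i∉C = contradiction i∈C i∉C
      out-C : ∀ i → ¬ i ∈ˢ C → length (blockX i) ≡ 2
      out-C i i∉C with i ∈? C
      ... | yes i∈C = contradiction i∈C i∉C
      ... | no  _   = refl

    length-Y : ∀ j → length (blockY j) ≡ 4
    length-Y j with C-covers j
    ... | inj₁ _ = refl
    ... | inj₂ _ = refl

  length-parsing : ∀ i → length (parsing i) ≡ 4 * n + 6 * m + ∣ C ∣ + ℓ * i
  length-parsing zero = trans (List.length-++ VEX) (trans (cong₂ _+_
    (trans (List.length-++ VE) (cong₂ _+_
      (trans (List.length-++ (concat (tabulate blockV)))
        (cong₂ _+_ (length-blocks blockV 2 (λ _ → refl)) (length-blocks blockE 2 (λ _ → refl))))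
      length-X))
    (length-blocks blockY 4 length-Y)) (sum n m ∣ C ∣ ℓ))
    where
    sum : ∀ n m k ℓ → n * 2 + m * 2 + (n * 2 + k) + m * 4 ≡ 4 * n + 6 * m + k + ℓ * 0
    sum = solve-∀
  length-parsing (suc i) = trans (List.length-++ (parsing i)) (trans
    (cong₂ _+_ (length-parsing i) (length-blocks (blockC i) 1 (λ _ → refl)))
    (sum (4 * n + 6 * m + ∣ C ∣) ℓ i))
    where
    sum : ∀ a ℓ i → a + ℓ * i + ℓ * 1 ≡ a + ℓ * suc i
    sum = solve-∀

theorem2 : ∀ (n m : ℕ) (G : Graph n m) → IsSimple G →
    (c k ℓ : ℕ) → 1 ≤ c → k ≤ n → k < ℓ →
    HasVertexCover G k ⇔
    (Σ Parsing λ ps → IsBLZ c (Construction.sG G c ℓ) ps ×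
    (length ps ≡ 4 * n + 6 * m + k + ℓ * (c ∸ 1)))
theorem2 n m G (irreflexive , _) (suc J) k ℓ (s≤s z≤n) k≤n k<ℓ = mk⇔ to from
  where
  to : HasVertexCover G k → _
  to (C , refl , covers) = Forward.parsing G J ℓ C covers J ,
    Forward.is-BLZ G J ℓ C covers , Forward.length-parsing G J ℓ C covers J

  from : (Σ Parsing λ ps → IsBLZ (suc J) (Construction.sG G (suc J) ℓ) ps ×
         (length ps ≡ 4 * n + 6 * m + k + ℓ * J)) → HasVertexCover G k
  from (ps , blz , size) with enlarge (toSubset cover) (≤-trans (∣toSubset∣ cover) length-cover) k≤n
    where open Converse G irreflexive J k ℓ k<ℓ ps blz size
  ... | D , ∣D∣≡k , cover⊆D = D , ∣D∣≡k , λ j →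
    Sum.map (cover⊆D ∘ ∈-toSubset) (cover⊆D ∘ ∈-toSubset) (all-covered j)
    where open Converse G irreflexive J k ℓ k<ℓ ps blz size
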